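{- For every triple of positive integers $r,d,m$, there exists $c=c(r,m)>0$, depending only on $r$ and $m$ (and not on $d$), such that for every positive integer $n$, $$R_{r}^{d,1,m}(n)\leq 2^{cn^{4r^{2}m^{2}}}.$$
   Context: An $r$-uniform hypergraph $H$ is semi-algebraic of complexity $(d,D,m)$ if there is an enumeration $v_1,\dots,v_N$ of its vertices, an assignment $v_i\mapsto p_i\in\mathbb{R}^d$ for $i\in[N]=\{1,\dots,N\}$, $m$ polynomials $f_1,\dots,f_m:(\mathbb{R}^d)^r\to\mathbb{R}$ of (total) degree at most $D$, and a function $\Phi:\{+,-,0\}^m\to\{\text{True},\text{False}\}$ such that for all $1\le i_1<\dots<i_r\le N$, the set $\{v_{i_1},\dots,v_{i_r}\}$ is an edge of $H$ if and only if $\Phi(\operatorname{sign}f_1(p_{i_1},\dots,p_{i_r}),\dots,\operatorname{sign}f_m(p_{i_1},\dots,p_{i_r}))=\text{True}$, where $\operatorname{sign}(x)\in\{+,-,0\}$ is the sign of $x$. The Ramsey number $R_r^{d,D,m}(n)$ is the smallest $N$ such that every $r$-uniform semi-algebraic hypergraph of complexity $(d,D,m)$ on $N$ vertices contains either a clique of size $n$ (a set of $n$ vertices all of whose $r$-element subsets are edges) or an independent set of size $n$ (a set of $n$ vertices none of whose $r$-element subsets is an edge). -}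

module Defs where

open import Axiom.ExcludedMiddle using (ExcludedMiddle)
open import Data.Bool.Base using (Bool; T)
open import Data.Fin.Base using (Fin) renaming (_<_ to _<ꟳ_)
open import Data.Fin.Permutation using (Permutation′; _⟨$⟩ʳ_)
open import Data.Fin.Subset using (Subset; ⁅_⁆; ⋃; _⊆_; ∣_∣)
open import Data.List.Base as List using (List; []; _∷_; length)
open import Data.List.Relation.Unary.All using (All)
open import Data.Nat.Base using (ℕ; _≤_; _<_; _⊔_)
open import Data.Nat.Induction using (<-rec)
import Data.Nat.Properties as ℕ
open import Data.Product.Base using (_×_; _,_; ∃-syntax; proj₁; proj₂)
open import Data.Rational.Base as ℚ using (ℚ; 0ℚ; 1ℚ; ½)
import Data.Rational.Properties as ℚ
open import Data.Rational.Solver using (module +-*-Solver)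
open import Data.Sum.Base using (_⊎_)
open import Data.Vec.Base using (Vec; lookup)
open import Function.Base using (_∘_)
open import Function.Bundles using (_⇔_)
open import Level using (0ℓ)
open import Relation.Binary.PropositionalEquality
open import Relation.Nullary using (¬_; Dec; yes; no)

------------------------------------------------------------------------
-- Real numbers: Cauchy sequences of rationals, with equality _≃_

IsCauchy : (ℕ → ℚ) → Set
IsCauchy x = ∀ ε → 0ℚ ℚ.< ε →
  ∃[ k ] (∀ i j → k ≤ i → k ≤ j → ℚ.∣ x i ℚ.- x j ∣ ℚ.≤ ε)

record ℝ : Set where
  constructor mkℝ
  field
    seq    : ℕ → ℚ
    cauchy : IsCauchy seq

open ℝ public

infix 4 _≃ᴿ_ _<ᴿ_
infixl 6 _+ᴿ_
infixl 7 _*ᴿ_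

_≃ᴿ_ : ℝ → ℝ → Set
x ≃ᴿ y = ∀ ε → 0ℚ ℚ.< ε →
  ∃[ k ] (∀ i → k ≤ i → ℚ.∣ seq x i ℚ.- seq y i ∣ ℚ.≤ ε)

_<ᴿ_ : ℝ → ℝ → Set
x <ᴿ y = ∃[ ε ] (0ℚ ℚ.< ε ×
  ∃[ k ] (∀ i → k ≤ i → seq x i ℚ.+ ε ℚ.≤ seq y i))

fromℚ : ℚ → ℝ
fromℚ q = mkℝ (λ _ → q) λ ε 0<ε → 0 , λ _ _ _ _ →
  ℚ.≤-trans (ℚ.≤-reflexive (cong ℚ.∣_∣ (ℚ.+-inverseʳ q))) (ℚ.<⇒≤ 0<ε)

0ᴿ 1ᴿ : ℝ
0ᴿ = fromℚ 0ℚ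
1ᴿ = fromℚ 1ℚ

private
  open +-*-Solver using (solve; _:+_; _:*_; _:-_; _:=_)

  [a-b]+b : ∀ a b → (a ℚ.- b) ℚ.+ b ≡ a
  [a-b]+b = solve 2 (λ a b → (a :- b) :+ b := a) refl

  sum-diff : ∀ a b c d → (a ℚ.+ b) ℚ.- (c ℚ.+ d) ≡ (a ℚ.- c) ℚ.+ (b ℚ.- d)
  sum-diff = solve 4 (λ a b c d → (a :+ b) :- (c :+ d) := (a :- c) :+ (b :- d)) refl

  product-diff : ∀ a b c d → a ℚ.* b ℚ.- c ℚ.* d ≡ a ℚ.* (b ℚ.- d) ℚ.+ (a ℚ.- c) ℚ.* d
  product-diff = solve 4 (λ a b c d → a :* b :- c :* d := a :* (b :- d) :+ (a :- c) :* d) refl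

  collect : ∀ a b e c → a ℚ.* (e ℚ.* c) ℚ.+ (e ℚ.* c) ℚ.* b ≡ e ℚ.* (c ℚ.* (a ℚ.+ b))
  collect = solve 4 (λ a b e c → a :* (e :* c) :+ (e :* c) :* b := e :* (c :* (a :+ b))) refl

_+ᴿ_ : ℝ → ℝ → ℝ
x +ᴿ y = mkℝ (λ i → seq x i ℚ.+ seq y i) +-cauchy
  where
  open ℚ.≤-Reasoning

  +-cauchy : IsCauchy (λ i → seq x i ℚ.+ seq y i)
  +-cauchy ε 0<ε = k ⊔ l , λ i j ki kj → begin
    ℚ.∣ (seq x i ℚ.+ seq y i) ℚ.- (seq x j ℚ.+ seq y j) ∣
      ≡⟨ cong ℚ.∣_∣ (sum-diff (seq x i) (seq y i) (seq x j) (seq y j)) ⟩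
    ℚ.∣ (seq x i ℚ.- seq x j) ℚ.+ (seq y i ℚ.- seq y j) ∣
      ≤⟨ ℚ.∣p+q∣≤∣p∣+∣q∣ (seq x i ℚ.- seq x j) (seq y i ℚ.- seq y j) ⟩
    ℚ.∣ seq x i ℚ.- seq x j ∣ ℚ.+ ℚ.∣ seq y i ℚ.- seq y j ∣
      ≤⟨ ℚ.+-mono-≤
           (proj₂ (cauchy x δ 0<δ) i j (ℕ.m⊔n≤o⇒m≤o k l ki) (ℕ.m⊔n≤o⇒m≤o k l kj))
           (proj₂ (cauchy y δ 0<δ) i j (ℕ.m⊔n≤o⇒n≤o k l ki) (ℕ.m⊔n≤o⇒n≤o k l kj)) ⟩
    δ ℚ.+ δ
      ≡⟨ ℚ.*-distribʳ-+ ε ½ ½ ⟨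
    1ℚ ℚ.* ε
      ≡⟨ ℚ.*-identityˡ ε ⟩
    ε ∎
    where
    δ : ℚ
    δ = ½ ℚ.* ε

    0<δ : 0ℚ ℚ.< δ
    0<δ = ℚ.positive⁻¹ δ {{ℚ.pos*pos⇒pos ½ ε {{ℚ.positive 0<ε}}}}

    k l : ℕ
    k = proj₁ (cauchy x δ 0<δ)
    l = proj₁ (cauchy y δ 0<δ)

eventuallyBounded : ∀ x → ∃[ M ] (0ℚ ℚ.< M × ∃[ k ] (∀ i → k ≤ i → ℚ.∣ seq x i ∣ ℚ.≤ M))
eventuallyBounded x with k , p ← cauchy x 1ℚ (ℚ.positive⁻¹ 1ℚ) =
  1ℚ ℚ.+ ℚ.∣ seq x k ∣ , ℚ.+-mono-<-≤ (ℚ.positive⁻¹ 1ℚ) (ℚ.0≤∣p∣ (seq x k)) , k , λ i ki → begin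
    ℚ.∣ seq x i ∣
      ≡⟨ cong ℚ.∣_∣ ([a-b]+b (seq x i) (seq x k)) ⟨
    ℚ.∣ (seq x i ℚ.- seq x k) ℚ.+ seq x k ∣
      ≤⟨ ℚ.∣p+q∣≤∣p∣+∣q∣ (seq x i ℚ.- seq x k) (seq x k) ⟩
    ℚ.∣ seq x i ℚ.- seq x k ∣ ℚ.+ ℚ.∣ seq x k ∣
      ≤⟨ ℚ.+-monoˡ-≤ ℚ.∣ seq x k ∣ (p i k ki ℕ.≤-refl) ⟩
    1ℚ ℚ.+ ℚ.∣ seq x k ∣ ∎
  where
  open ℚ.≤-Reasoning

∣*∣-mono : ∀ p q {M N} → ℚ.∣ p ∣ ℚ.≤ M → ℚ.∣ q ∣ ℚ.≤ N → ℚ.∣ p ℚ.* q ∣ ℚ.≤ M ℚ.* N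
∣*∣-mono p q {M} {N} p≤M q≤N = begin
  ℚ.∣ p ℚ.* q ∣           ≡⟨ ℚ.∣p*q∣≡∣p∣*∣q∣ p q ⟩
  ℚ.∣ p ∣ ℚ.* ℚ.∣ q ∣     ≤⟨ ℚ.*-monoʳ-≤-nonNeg ℚ.∣ q ∣ {{ℚ.∣-∣-nonNeg q}} p≤M ⟩
  M ℚ.* ℚ.∣ q ∣           ≤⟨ ℚ.*-monoˡ-≤-nonNeg M {{ℚ.nonNegative (ℚ.≤-trans (ℚ.0≤∣p∣ p) p≤M)}} q≤N ⟩
  M ℚ.* N                 ∎
  where open ℚ.≤-Reasoning

_*ᴿ_ : ℝ → ℝ → ℝ
x *ᴿ y = mkℝ (λ i → seq x i ℚ.* seq y i) *-cauchy
  where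
  open ℚ.≤-Reasoning

  *-cauchy : IsCauchy (λ i → seq x i ℚ.* seq y i)
  *-cauchy ε 0<ε = *-cauchy′ (eventuallyBounded x) (eventuallyBounded y)
    where
    *-cauchy′ : ∃[ M ] (0ℚ ℚ.< M × ∃[ k ] (∀ i → k ≤ i → ℚ.∣ seq x i ∣ ℚ.≤ M)) →
                ∃[ N ] (0ℚ ℚ.< N × ∃[ k ] (∀ i → k ≤ i → ℚ.∣ seq y i ∣ ℚ.≤ N)) →
                ∃[ k ] (∀ i j → k ≤ i → k ≤ j →
                  ℚ.∣ seq x i ℚ.* seq y i ℚ.- seq x j ℚ.* seq y j ∣ ℚ.≤ ε)
    *-cauchy′ (M , 0<M , k₁ , p₁) (N , 0<N , k₂ , p₂) =
      k₁ ⊔ k₂ ⊔ (k₃ ⊔ k₄) , λ i j ki kj → begin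
        ℚ.∣ seq x i ℚ.* seq y i ℚ.- seq x j ℚ.* seq y j ∣
          ≡⟨ cong ℚ.∣_∣ (product-diff (seq x i) (seq y i) (seq x j) (seq y j)) ⟩
        ℚ.∣ seq x i ℚ.* (seq y i ℚ.- seq y j) ℚ.+ (seq x i ℚ.- seq x j) ℚ.* seq y j ∣
          ≤⟨ ℚ.∣p+q∣≤∣p∣+∣q∣ (seq x i ℚ.* (seq y i ℚ.- seq y j)) ((seq x i ℚ.- seq x j) ℚ.* seq y j) ⟩
        ℚ.∣ seq x i ℚ.* (seq y i ℚ.- seq y j) ∣ ℚ.+ ℚ.∣ (seq x i ℚ.- seq x j) ℚ.* seq y j ∣
          ≤⟨ ℚ.+-mono-≤
               (∣*∣-mono (seq x i) (seq y i ℚ.- seq y j) (p₁ i (≥k₁ ki)) (p₄ i j (≥k₄ ki) (≥k₄ kj)))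
               (∣*∣-mono (seq x i ℚ.- seq x j) (seq y j) (p₃ i j (≥k₃ ki) (≥k₃ kj)) (p₂ j (≥k₂ kj))) ⟩
        M ℚ.* δ ℚ.+ δ ℚ.* N
          ≡⟨ collect M N ε (ℚ.1/ (M ℚ.+ N)) ⟩
        ε ℚ.* (ℚ.1/ (M ℚ.+ N) ℚ.* (M ℚ.+ N))
          ≡⟨ cong (ε ℚ.*_) (ℚ.*-inverseˡ (M ℚ.+ N)) ⟩
        ε ℚ.* 1ℚ
          ≡⟨ ℚ.*-identityʳ ε ⟩
        ε ∎
      where
      instance
        M+N>0 : ℚ.Positive (M ℚ.+ N)
        M+N>0 = ℚ.positive (ℚ.+-mono-< 0<M 0<N)

        M+N≢0 : ℚ.NonZero (M ℚ.+ N)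
        M+N≢0 = ℚ.pos⇒nonZero (M ℚ.+ N)

        1/>0 : ℚ.Positive (ℚ.1/ (M ℚ.+ N))
        1/>0 = ℚ.1/pos⇒pos (M ℚ.+ N)

        ε>0 : ℚ.Positive ε
        ε>0 = ℚ.positive 0<ε

      δ : ℚ
      δ = ε ℚ.* ℚ.1/ (M ℚ.+ N)

      0<δ : 0ℚ ℚ.< δ
      0<δ = ℚ.positive⁻¹ δ {{ℚ.pos*pos⇒pos ε (ℚ.1/ (M ℚ.+ N))}}

      k₃ k₄ : ℕ
      k₃ = proj₁ (cauchy x δ 0<δ)
      k₄ = proj₁ (cauchy y δ 0<δ)

      p₃ : ∀ i j → k₃ ≤ i → k₃ ≤ j → ℚ.∣ seq x i ℚ.- seq x j ∣ ℚ.≤ δ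
      p₃ = proj₂ (cauchy x δ 0<δ)

      p₄ : ∀ i j → k₄ ≤ i → k₄ ≤ j → ℚ.∣ seq y i ℚ.- seq y j ∣ ℚ.≤ δ
      p₄ = proj₂ (cauchy y δ 0<δ)

      ≥k₁ : ∀ {i} → k₁ ⊔ k₂ ⊔ (k₃ ⊔ k₄) ≤ i → k₁ ≤ i
      ≥k₁ = ℕ.m⊔n≤o⇒m≤o k₁ k₂ ∘ ℕ.m⊔n≤o⇒m≤o (k₁ ⊔ k₂) (k₃ ⊔ k₄)

      ≥k₂ : ∀ {i} → k₁ ⊔ k₂ ⊔ (k₃ ⊔ k₄) ≤ i → k₂ ≤ i
      ≥k₂ = ℕ.m⊔n≤o⇒n≤o k₁ k₂ ∘ ℕ.m⊔n≤o⇒m≤o (k₁ ⊔ k₂) (k₃ ⊔ k₄)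

      ≥k₃ : ∀ {i} → k₁ ⊔ k₂ ⊔ (k₃ ⊔ k₄) ≤ i → k₃ ≤ i
      ≥k₃ = ℕ.m⊔n≤o⇒m≤o k₃ k₄ ∘ ℕ.m⊔n≤o⇒n≤o (k₁ ⊔ k₂) (k₃ ⊔ k₄)

      ≥k₄ : ∀ {i} → k₁ ⊔ k₂ ⊔ (k₃ ⊔ k₄) ≤ i → k₄ ≤ i
      ≥k₄ = ℕ.m⊔n≤o⇒n≤o k₃ k₄ ∘ ℕ.m⊔n≤o⇒n≤o (k₁ ⊔ k₂) (k₃ ⊔ k₄)

data Sign : Set where
  pos neg nul : Sign

-- The graph of the sign function.  As a function into Sign it would not
-- be computable; classically every real has exactly one sign.
HasSign : ℝ → Sign → Set
HasSign x pos = 0ᴿ <ᴿ x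
HasSign x neg = x <ᴿ 0ᴿ
HasSign x nul = x ≃ᴿ 0ᴿ

------------------------------------------------------------------------
-- Real polynomials in variables X

-- A monomial is a word of variables, so its degree is its length.
Polynomial : Set → Set
Polynomial X = List (ℝ × List X)

HasDegree≤ : {X : Set} → ℕ → Polynomial X → Set
HasDegree≤ {X} D = All {A = ℝ × List X} (λ (_ , w) → length w ≤ D)

evalMonomial : {X : Set} → List X → (X → ℝ) → ℝ
evalMonomial w x = List.foldr (λ v y → x v *ᴿ y) 1ᴿ w

eval : {X : Set} → Polynomial X → (X → ℝ) → ℝ
eval f x = List.foldr (λ (a , w) y → a *ᴿ evalMonomial w x +ᴿ y) 0ᴿ f

------------------------------------------------------------------------
-- Hypergraphs

record UniformHypergraph (r N : ℕ) : Set where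
  field
    isEdge  : Subset N → Bool
    uniform : ∀ e → T (isEdge e) → ∣ e ∣ ≡ r

  Edge : Subset N → Set
  Edge e = T (isEdge e)

open UniformHypergraph public using (Edge)

IsClique : ∀ {r N} → UniformHypergraph r N → Subset N → Set
IsClique {r} H S = ∀ e → ∣ e ∣ ≡ r → e ⊆ S → Edge H e

IsIndependent : ∀ {r N} → UniformHypergraph r N → Subset N → Set
IsIndependent {r} H S = ∀ e → ∣ e ∣ ≡ r → e ⊆ S → ¬ Edge H e

-- ⟦ v ⟧ is the set { v 0 , … , v (r - 1) }.
⟦_⟧ : ∀ {r N} → (Fin r → Fin N) → Subset N
⟦ v ⟧ = ⋃ (List.tabulate (⁅_⁆ ∘ v))

StrictlyIncreasing : ∀ {r N} → (Fin r → Fin N) → Set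
StrictlyIncreasing i = ∀ {a b} → a <ꟳ b → i a <ꟳ i b

record Description (d D m r N : ℕ) : Set where
  field
    enumeration : Permutation′ N
    point       : Fin N → Fin d → ℝ
    poly        : Fin m → Polynomial (Fin r × Fin d)
    degree      : ∀ l → HasDegree≤ D (poly l)
    Φ           : Vec Sign m → Bool

-- The variable (a , b) of a polynomial on (ℝᵈ)ʳ is the b-th coordinate
-- of the a-th point.
HasSigns : ∀ {d m r} → (Fin m → Polynomial (Fin r × Fin d)) → (Fin r → Fin d → ℝ) → Vec Sign m → Set
HasSigns f p s = ∀ l → HasSign (eval (f l) (λ (a , b) → p a b)) (lookup s l)

_Describes_ : ∀ {d D m r N} → Description d D m r N → UniformHypergraph r N → Set
_Describes_ {r = r} {N} Δ H =
  ∀ (i : Fin r → Fin N) → StrictlyIncreasing i →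
  Edge H ⟦ (enumeration ⟨$⟩ʳ_) ∘ i ⟧ ⇔ (∃[ s ] (HasSigns poly (point ∘ i) s × T (Φ s)))
  where open Description Δ

SemiAlgebraic : (d D m : ℕ) {r N : ℕ} → UniformHypergraph r N → Set
SemiAlgebraic d D m {r} {N} H = ∃[ Δ ] (_Describes_ {d} {D} {m} {r} {N} Δ H)

------------------------------------------------------------------------
-- Ramsey numbers

-- The Ramsey number R_r^{d,D,m}(n) is the least N satisfying this.
RamseyProperty : (r d D m n N : ℕ) → Set
RamseyProperty r d D m n N =
  ∀ (H : UniformHypergraph r N) → SemiAlgebraic d D m H →
  ∃[ S ] (∣ S ∣ ≡ n × (IsClique H S ⊎ IsIndependent H S))

IsLeast : (ℕ → Set) → ℕ → Set
IsLeast P R = P R × (∀ N → P N → R ≤ N)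

-- "The smallest N satisfying P is at most B."  Without excluded middle an
-- inhabited set of naturals need not have a least element, so the first
-- component asks for some element up to B; least-exists then recovers the
-- least one classically.
infix 3 _HasLeast≤_

_HasLeast≤_ : (ℕ → Set) → ℕ → Set
P HasLeast≤ B = (∃[ N ] (P N × N ≤ B)) × (∀ R → IsLeast P R → R ≤ B)

least-exists : ExcludedMiddle 0ℓ → ∀ {P B} → P HasLeast≤ B → ∃[ R ] (IsLeast P R × R ≤ B)
least-exists em {P} {B} ((N , PN , N≤B) , bound) =
  let R , least = go N PN in R , least , bound R least
  where
  go : ∀ N → P N → ∃[ R ] IsLeast P R
  go = <-rec _ λ N rec PN → step N rec PN em
    where
    step : ∀ N → (∀ {K} → K < N → P K → ∃[ R ] IsLeast P R) → P N →
           Dec (∃[ K ] (K < N × P K)) → ∃[ R ] IsLeast P R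
    step N rec PN (yes (K , K<N , PK)) = rec K<N PK
    step N rec PN (no none) = N , PN , λ K PK → ℕ.≮⇒≥ λ K<N → none (K , K<N , PK)

{-# OPTIONS --safe #-}

-- A linear form in the points p_{i₁}, …, p_{i_r} is a sum of r numbers, the
-- a-th of which depends only on p_{i_a}.  So the dimension d disappears: only
-- the signs of c + x₁(i₁) + … + x_r(i_r) matter, for k = r m real sequences x
-- altogether.  Whether a homogeneous set exists is decidable, so one may argue
-- up to double negation, and replace the reals first by rationals with a
-- threshold for the sign and then, after scaling, by integers.
--
-- An Erdős–Rado argument, which costs one exponential, makes all sequences
-- monotone and makes the comparisons x_t(j) - x_t(i) ≤ x_t′(l) - x_t′(j), for
-- i < j < l, independent of l.  What remains are k² relations between i and j
-- that pass to subintervals, so all of them become constant on an arithmetic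
-- progression at the cost of a polynomial of degree k² + 1.  Then each sequence
-- is lacunary: measured from one of its ends it at least doubles or halves at
-- each step, and any two of them are comparable up to a factor.  On a sparse
-- subprogression a single summand dominates all others and the constant,
-- and its sign is the sign of the sum.
module Submission where

open import Defs
open import Data.Bool.Base using (Bool; true; false; T)
import Data.Bool.Properties as Bool
open import Data.Fin.Base as Fin using (Fin; zero; suc; toℕ; fromℕ<; punchIn; punchOut; combine; remQuot)
open import Data.Fin.Permutation using (_⟨$⟩ʳ_; _⟨$⟩ˡ_)
import Data.Fin.Permutation as Permutation
import Data.Fin.Properties as Fin
open import Data.Fin.Subset using (Subset; inside; outside; ⁅_⁆; ⋃; _∪_)
  renaming (_∈_ to _∈ˢ_; _∉_ to _∉ˢ_; _⊆_ to _⊆ˢ_; ∣_∣ to ∣_∣ˢ)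
import Data.Fin.Subset.Properties as Subset
open import Data.Integer.Base as ℤ using (ℤ; +_; -[1+_]; 0ℤ; ∣_∣)
import Data.Integer.Properties as ℤ
import Data.Integer.Tactic.RingSolver as ℤ-Solver
open import Data.List.Base as List using (List; []; _∷_; _++_; length; map; filter)
open import Data.List.Membership.Propositional using (_∈_)
import Data.List.Membership.Propositional.Properties as List
import Data.List.Properties as List
open import Data.List.Relation.Binary.Sublist.Propositional as Sublist
  using (_⊆_; []; _∷_; _∷ʳ_; ⊆-refl; ⊆-trans)
open import Data.List.Relation.Binary.Sublist.Propositional.Properties using (filter-⊆)
open import Data.List.Relation.Unary.All as All using (All; []; _∷_)
import Data.List.Relation.Unary.All.Properties as All
open import Data.List.Relation.Unary.AllPairs using (AllPairs; []; _∷_)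
import Data.List.Relation.Unary.AllPairs.Properties as AllPairs
open import Data.List.Relation.Unary.Any using (here; there)
open import Data.Nat.Base hiding (∣_-_∣)
open import Data.Nat.Properties
open import Data.Nat.Tactic.RingSolver using (solve-∀)
open import Data.Product.Base using (_×_; _,_; ∃-syntax; proj₁; proj₂; uncurry)
open import Data.Rational.Base as ℚ using (ℚ; 0ℚ; 1ℚ; ½; mkℚ)
open import Data.Rational.Literals using () renaming (fromℤ to ι)
import Data.Rational.Properties as ℚ
open import Data.Rational.Solver using (module +-*-Solver)
open import Data.Rational.Unnormalised.Base using (*≡*)
import Data.Rational.Unnormalised.Properties as ℚᵘ
open import Data.Sum.Base as Sum using (_⊎_; inj₁; inj₂; [_,_]′)
open import Data.Unit.Base using (⊤; tt)
open import Data.Vec.Base as Vec using (Vec; []; _∷_; lookup; tabulate; here; there)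
open import Data.Vec.Functional using (removeAt)
import Data.Vec.Properties as Vec
open import Function.Base using (_∘_; const; case_of_)
open import Function.Bundles using (_⇔_; Equivalence)
open import Relation.Binary.Definitions using (tri<; tri≈; tri>)
open import Relation.Binary.PropositionalEquality
open import Relation.Nullary using (¬_; Dec; yes; no; contradiction; ¬?)
open import Relation.Nullary.Decidable
  using (⌊_⌋; ¬¬-excluded-middle; _×-dec_; _⊎-dec_; _→-dec_; decidable-stable; map′)
open import Algebra.Properties.CommutativeMonoid.Sum ℤ.+-0-commutativeMonoid
  using (sum; sum-remove; ∑-distrib-+; sum-cong-≗)
import Algebra.Properties.CommutativeMonoid.Sum ℚ.+-0-commutativeMonoid as ℚΣ

-- Erdős–Rado sequences

-- The sign of a sum involves all `r` indices at once, and the general Ramsey argument pays an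
-- exponential for each further index. Comparisons of adjacent gaps involve three indices whatever
-- `r` is, and yet they determine how the sequences grow relative to one another. Removing the
-- dependence on the third index is therefore the only exponential step. After the final thinning,
-- which of two summands is larger depends on their places in the sum and not on the indices chosen,
-- so the same summand dominates for all tuples. The exponent of the bound is twice `k² + 1`: the
-- number of levels of the tree is at most of order `n ^ (k² + 1)`, and at each level the list is
-- halved once for every test accumulated so far, whose number is again bounded by a multiple of the
-- number of levels. As `k` is positive, `2 (k² + 1)` is at most `4 k²`.

Constant : {A : Set} → (A → Bool) → List A → Set
Constant p xs = ∀ x y → x ∈ xs → y ∈ xs → p x ≡ p y

halve : ∀ M a b → 2 * M ≤ a + b → M ≤ a ⊎ M ≤ b
halve M a b h with M ≤? a
... | yes M≤a = inj₁ M≤a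
... | no  M≰a = inj₂ (≮⇒≥ λ b<M → <-irrefl refl (begin-strict
  a + b   <⟨ +-mono-< (≰⇒> M≰a) b<M ⟩
  M + M   ≡⟨ cong (_+_ M) (+-identityʳ M) ⟨
  2 * M   ≤⟨ h ⟩
  a + b   ∎))
  where open ≤-Reasoning

module _ {A : Set} where

  length-filter-∁ : (p : A → Bool) (xs : List A) →
    length (filter ((Bool._≟ true) ∘ p) xs) + length (filter ((Bool._≟ false) ∘ p) xs) ≡ length xs
  length-filter-∁ p []       = refl
  length-filter-∁ p (x ∷ xs) with p x
  ... | true  = cong suc (length-filter-∁ p xs)
  ... | false = trans (+-suc _ _) (cong suc (length-filter-∁ p xs))

  filter-constant : (p : A → Bool) (b : Bool) (xs : List A) → Constant p (filter ((Bool._≟ b) ∘ p) xs)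
  filter-constant p b xs _ _ x∈ y∈ = trans (value x∈) (sym (value y∈))
    where
    value : ∀ {x} → x ∈ filter ((Bool._≟ b) ∘ p) xs → p x ≡ b
    value = All.lookup (All.all-filter ((Bool._≟ b) ∘ p) xs)

  -- Pigeonhole, one test at a time: one of the two classes of a test is still large enough for the
  -- remaining tests, so each test costs a factor 2.
  constantSublist : (ps : List (A → Bool)) (xs : List A) (M : ℕ) → 2 ^ length ps * M ≤ length xs →
    ∃[ ys ] (ys ⊆ xs × M ≤ length ys × All (λ p → Constant p ys) ps)
  constantSublist []       xs M h = xs , ⊆-refl , subst (_≤ length xs) (+-identityʳ M) h , []
  constantSublist (p ∷ ps) xs M h = case majority of λ where
      (inj₁ h₁) → descend true h₁
      (inj₂ h₂) → descend false h₂
    where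
    part : Bool → List A
    part b = filter ((Bool._≟ b) ∘ p) xs

    majority : 2 ^ length ps * M ≤ length (part true) ⊎ 2 ^ length ps * M ≤ length (part false)
    majority = halve (2 ^ length ps * M) _ _ (begin
      2 * (2 ^ length ps * M)                      ≡⟨ *-assoc 2 (2 ^ length ps) M ⟨
      2 ^ length (p ∷ ps) * M                      ≤⟨ h ⟩
      length xs                                    ≡⟨ length-filter-∁ p xs ⟨
      length (part true) + length (part false)     ∎)
      where open ≤-Reasoning

    descend : ∀ b → 2 ^ length ps * M ≤ length (part b) →
      ∃[ ys ] (ys ⊆ xs × M ≤ length ys × All (λ p → Constant p ys) (p ∷ ps))
    descend b h with ys , ys⊆ , M≤ , consts ← constantSublist ps (part b) M h =
      ys , ⊆-trans ys⊆ (filter-⊆ _ xs) , M≤ ,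
      (λ x y x∈ y∈ → filter-constant p b xs x y (Sublist.lookup ys⊆ x∈) (Sublist.lookup ys⊆ y∈)) ∷ consts

  AllPairs-resp-⊆ : {R : A → A → Set} {xs ys : List A} → ys ⊆ xs → AllPairs R xs → AllPairs R ys
  AllPairs-resp-⊆ []         []       = []
  AllPairs-resp-⊆ (y ∷ʳ τ)   (_ ∷ ps) = AllPairs-resp-⊆ τ ps
  AllPairs-resp-⊆ (refl ∷ τ) (p ∷ ps) = All.anti-mono (Sublist.lookup τ) p ∷ AllPairs-resp-⊆ τ ps

  FirstDetermined : (A → A → Bool) → ℕ → (ℕ → A) → Set
  FirstDetermined ρ L z = ∀ j k k′ → j < k → k < L → j < k′ → k′ < L → ρ (z j) (z k) ≡ ρ (z j) (z k′)

  -- The case `i ≡ j` is included so that a binary relation can be posed as a ternary test that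
  -- ignores its middle argument.
  FirstTwoDetermined : (A → A → A → Bool) → ℕ → (ℕ → A) → Set
  FirstTwoDetermined τ L z = ∀ i j k k′ → i ≤ j → j < k → k < L → j < k′ → k′ < L →
    τ (z i) (z j) (z k) ≡ τ (z i) (z j) (z k′)

  consSeq : A → (ℕ → A) → ℕ → A
  consSeq y z zero    = y
  consSeq y z (suc i) = z i

  -- The Erdős–Rado argument: the head of the list is chosen, and then the
  -- list is thinned out so that all tests involving the chosen elements
  -- and one further element become constant.
  module _ {_<ₐ_ : A → A → Set} (τs : List (A → A → A → Bool)) where

    private
      specialise : A → List (A → A → Bool) → List (A → A → Bool)
      specialise x ρs = map (λ τ → τ x) τs ++ ρs

      unary : A → List (A → A → Bool) → List (A → Bool)
      unary x ρs = map (λ ρ → ρ x) (specialise x ρs)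

      -- Each chosen element turns every ternary test into one more binary test. The binary tests
      -- present and those still to come thus have a constant total, and a single bound `B` serves
      -- every stage.
      length-specialise : ∀ x ρs L →
        length (specialise x ρs) + L * length τs ≡ length ρs + suc L * length τs
      length-specialise x ρs L = begin
        length (specialise x ρs) + L * length τs   ≡⟨ cong (_+ L * length τs) (List.length-++ (map (λ τ → τ x) τs)) ⟩
        length (map (λ τ → τ x) τs) + length ρs + L * length τs
          ≡⟨ cong (λ t → t + length ρs + L * length τs) (List.length-map _ τs) ⟩
        length τs + length ρs + L * length τs      ≡⟨ lemma (length τs) (length ρs) L ⟩
        length ρs + suc L * length τs              ∎
        where
        open ≡-Reasoning

        lemma : ∀ t s L → t + s + L * t ≡ s + (t + L * t)
        lemma = solve-∀

      -- At most `B` halvings take place at a level, and one more factor 2 pays for the loss of the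
      -- head, hence `suc B` per level.
      room : ∀ B L x ρs {M} → length ρs + suc L * length τs ≤ B → 2 ^ (suc B * suc L) ≤ suc M →
        2 ^ length (unary x ρs) * 2 ^ (suc B * L) ≤ M
      room B L x ρs {M} hB h = s≤s⁻¹ (begin
        suc (2 ^ length (unary x ρs) * 2 ^ (suc B * L))   ≡⟨ cong suc (^-distribˡ-+-* 2 (length (unary x ρs)) (suc B * L)) ⟨
        suc (2 ^ (length (unary x ρs) + suc B * L))       ≤⟨ s≤s (^-monoʳ-≤ 2 (+-monoˡ-≤ (suc B * L) unary≤B)) ⟩
        suc (2 ^ (B + suc B * L))                         ≤⟨ +-monoˡ-≤ (2 ^ (B + suc B * L)) (m^n>0 2 (B + suc B * L)) ⟩
        2 ^ (B + suc B * L) + 2 ^ (B + suc B * L)         ≡⟨ cong (_+_ (2 ^ (B + suc B * L))) (+-identityʳ _) ⟨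
        2 ^ suc (B + suc B * L)                           ≡⟨ cong (2 ^_) (*-suc (suc B) L) ⟨
        2 ^ (suc B * suc L)                               ≤⟨ h ⟩
        suc M                                             ∎)
        where
        open ≤-Reasoning

        unary≤B : length (unary x ρs) ≤ B
        unary≤B = begin
          length (unary x ρs)                          ≡⟨ List.length-map _ (specialise x ρs) ⟩
          length (specialise x ρs)                     ≤⟨ m≤m+n _ (L * length τs) ⟩
          length (specialise x ρs) + L * length τs     ≡⟨ length-specialise x ρs L ⟩
          length ρs + suc L * length τs                ≤⟨ hB ⟩
          B                                            ∎

    erdősRado : ∀ (B L : ℕ) (ρs : List (A → A → Bool)) (xs : List A) → AllPairs _<ₐ_ xs →
      length ρs + L * length τs ≤ B → 2 ^ (suc B * L) ≤ length xs →
      ∃[ z ] ((∀ {i} → i < L → z i ∈ xs) × (∀ {i j} → i < j → j < L → z i <ₐ z j) ×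
              All (λ ρ → FirstDetermined ρ L z) ρs × All (λ τ → FirstTwoDetermined τ L z) τs)
    erdősRado B L ρs [] _ _ h = contradiction h (<⇒≱ (m^n>0 2 (suc B * L)))
    erdősRado B zero ρs (x ∷ xs) _ _ _ =
      const x , (λ ()) , (λ _ ()) , All.universal (λ ρ _ _ _ _ ()) ρs , All.universal (λ τ _ _ _ _ _ _ ()) τs
    erdősRado B (suc L) ρs (x ∷ xs) (x< ∷ xs<) hB h
      with ys , ys⊆ , len , consts ← constantSublist (unary x ρs) xs (2 ^ (suc B * L)) (room B L x ρs hB h)
      with z , z∈ , z< , dρ , dτ ← erdősRado B L (specialise x ρs) ys (AllPairs-resp-⊆ ys⊆ xs<)
             (subst (_≤ B) (sym (length-specialise x ρs L)) hB) len =
        consSeq x z , z∈′ , z<′ ,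
        All.zipWith (λ {ρ} (c , d) → step ρ c d)
          (All.++⁻ʳ (map (λ τ → τ x) τs) (All.map⁻ consts) , All.++⁻ʳ (map (λ τ → τ x) τs) dρ) ,
        All.zipWith (λ {τ} ((c , d) , e) → step₂ τ c d e)
          (All.zip (All.map⁻ (All.++⁻ˡ (map (λ τ → τ x) τs) (All.map⁻ consts)) ,
                    All.map⁻ (All.++⁻ˡ (map (λ τ → τ x) τs) dρ)) , dτ)
      where
      z∈xs : ∀ {i} → i < L → z i ∈ xs
      z∈xs i<L = Sublist.lookup ys⊆ (z∈ i<L)

      z∈′ : ∀ {i} → i < suc L → consSeq x z i ∈ x ∷ xs
      z∈′ {zero}  _         = here refl
      z∈′ {suc i} (s≤s i<L) = there (z∈xs i<L)

      z<′ : ∀ {i j} → i < j → j < suc L → consSeq x z i <ₐ consSeq x z j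
      z<′ {zero}  {suc j} _         (s≤s j<L) = All.lookup x< (z∈xs j<L)
      z<′ {suc i} {suc j} (s≤s i<j) (s≤s j<L) = z< i<j j<L

      step : ∀ ρ → Constant (ρ x) ys → FirstDetermined ρ L z → FirstDetermined ρ (suc L) (consSeq x z)
      step ρ c d zero    (suc k) (suc k′) _         (s≤s k<L) _          (s≤s k′<L) =
        c (z k) (z k′) (z∈ k<L) (z∈ k′<L)
      step ρ c d (suc j) (suc k) (suc k′) (s≤s j<k) (s≤s k<L) (s≤s j<k′) (s≤s k′<L) =
        d j k k′ j<k k<L j<k′ k′<L

      step₂ : ∀ τ → Constant (τ x x) ys → FirstDetermined (τ x) L z → FirstTwoDetermined τ L z →
        FirstTwoDetermined τ (suc L) (consSeq x z)
      -- For `j` zero the constancy of `τ x x` on the thinned list decides, for larger `j` the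
      -- binary test `τ x`.
      step₂ τ c d e zero    j       k       k′       _         = step (τ x) c d j k k′
      step₂ τ c d e (suc i) (suc j) (suc k) (suc k′) (s≤s i≤j) (s≤s j<k) (s≤s k<L) (s≤s j<k′) (s≤s k′<L) =
        e i j k k′ i≤j j<k k<L j<k′ k′<L

-- Relations that pass to subintervals

private
  nextTerm : ∀ l s w → l + s * w + w ≡ l + suc s * w
  nextTerm = solve-∀

  term≤ : ∀ {n} l w (s : Fin n) → l + toℕ s * w + w ≤ l + n * w
  term≤ l w s = ≤-trans (≤-reflexive (nextTerm l (toℕ s) w)) (+-monoʳ-≤ l (*-monoˡ-≤ w (Fin.toℕ<n s)))

-- If no relation holds between consecutive points of the coarse
-- progression lo , lo + w , … , then none holds between any two of its
-- points; otherwise some relation holds throughout an interval of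
-- length w and can be dropped.
homogeneousProgression : ∀ p n .{{_ : NonZero n}} H (G : Fin p → ℕ → ℕ → Set) →
  (∀ c i j → Dec (G c i j)) →
  (∀ c {i i′ j′ j} → i ≤ i′ → i′ < j′ → j′ ≤ j → j ≤ H → G c i j → G c i′ j′) →
  ∀ lo → lo + n ^ suc p ≤ H →
  ∃[ start ] ∃[ d ] (0 < d × lo ≤ start × start + n * d ≤ lo + n ^ suc p ×
    (∀ c → (∀ a b → a < b → b ≤ n → G c (start + a * d) (start + b * d)) ⊎
           (∀ a b → a < b → b ≤ n → ¬ G c (start + a * d) (start + b * d))))
homogeneousProgression zero    n H G G? closed lo h =
  lo , 1 , s≤s z≤n , ≤-refl , ≤-refl , λ ()
homogeneousProgression (suc p) n H G G? closed lo h
  with Fin.any? (λ c → Fin.any? {n = n} (λ s → G? c (lo + toℕ s * n ^ suc p) (lo + suc (toℕ s) * n ^ suc p)))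
... | no none = lo , w , m^n>0 n (suc p) , ≤-refl , ≤-refl , λ c → inj₂ λ a b a<b b≤n g →
  none (c , fromℕ< (<-≤-trans a<b b≤n) ,
    subst (λ a → G c (lo + a * w) (lo + suc a * w)) (sym (Fin.toℕ-fromℕ< (<-≤-trans a<b b≤n)))
      (closed c ≤-refl (+-monoʳ-< lo (*-monoˡ-< w {{m^n≢0 n (suc p)}} (n<1+n a)))
        (+-monoʳ-≤ lo (*-monoˡ-≤ w a<b)) (≤-trans (+-monoʳ-≤ lo (*-monoˡ-≤ w b≤n)) h) g))
  where
  w = n ^ suc p
... | yes (c , s , g) with start , d , 0<d , lo≤ , ≤hi , hom ←
      homogeneousProgression p n H (G ∘ punchIn c) (G? ∘ punchIn c) (closed ∘ punchIn c)
        (lo + toℕ s * n ^ suc p) (≤-trans (term≤ lo (n ^ suc p) s) h) =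
  start , d , 0<d , ≤-trans (m≤m+n lo _) lo≤ ,
  ≤-trans ≤hi (term≤ lo w s) ,
  λ c′ → case c Fin.≟ c′ of λ where
    (yes refl) → inj₁ λ a b a<b b≤n →
      closed c (≤-trans lo≤ (m≤m+n start (a * d)))
        (+-monoʳ-< start (*-monoˡ-< d {{>-nonZero 0<d}} a<b))
        (≤-trans (+-monoʳ-≤ start (*-monoˡ-≤ d b≤n)) (≤-trans ≤hi (≤-reflexive (nextTerm lo (toℕ s) w))))
        (≤-trans (≤-reflexive (sym (nextTerm lo (toℕ s) w))) (≤-trans (term≤ lo w s) h)) g
    (no c≢c′)  → subst (λ c → (∀ a b → a < b → b ≤ n → G c (start + a * d) (start + b * d)) ⊎
                              (∀ a b → a < b → b ≤ n → ¬ G c (start + a * d) (start + b * d)))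
                       (Fin.punchIn-punchOut c≢c′) (hom (punchOut c≢c′))
  where
  w = n ^ suc p

-- Monotone predicates on an interval

AlwaysOrNever : (ℕ → Set) → ℕ → ℕ → Set
AlwaysOrNever P lo hi = (∀ i → lo ≤ i → i ≤ hi → P i) ⊎ (∀ i → lo ≤ i → i ≤ hi → ¬ P i)

IncreasingOrDecreasing : (ℕ → Set) → ℕ → Set
IncreasingOrDecreasing P H =
  (∀ i j → i ≤ j → j ≤ H → P i → P j) ⊎ (∀ i j → i ≤ j → j ≤ H → P j → P i)

-- The value of a monotone predicate at the midpoint settles it on one of the two halves, so each
-- predicate costs one halving.
constantInterval : ∀ q w H (P : Fin q → ℕ → Set) → (∀ c i → Dec (P c i)) →
  (∀ c → IncreasingOrDecreasing (P c) H) →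
  ∀ lo → lo + 2 ^ q * w ≤ H →
  ∃[ lo′ ] (lo ≤ lo′ × lo′ + w ≤ lo + 2 ^ q * w ×
    (∀ c → AlwaysOrNever (P c) lo′ (lo′ + w)))
constantInterval zero    w H P P? mono lo h = lo , ≤-refl , +-monoʳ-≤ lo (m≤m+n w 0) , λ ()
constantInterval (suc q) w H P P? mono lo h = choose (mono zero) (P? zero mid)
  where
  open ≤-Reasoning

  v = 2 ^ q * w
  mid = lo + v

  double : ∀ l p w → l + p * w + p * w ≡ l + 2 * p * w
  double = solve-∀

  hi≤ : mid + v ≤ H
  hi≤ = ≤-trans (≤-reflexive (double lo (2 ^ q) w)) h

  mid≤ : mid ≤ H
  mid≤ = ≤-trans (m≤m+n mid v) hi≤

  Good : ℕ → Set
  Good lo′ = lo ≤ lo′ × lo′ + w ≤ lo + 2 ^ suc q * w ×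
    (∀ c → AlwaysOrNever (P c) lo′ (lo′ + w))

  extend : ∀ l → lo ≤ l → l + v ≤ mid + v → AlwaysOrNever (P zero) l (l + v) →
    ∃[ lo′ ] Good lo′
  extend l lo≤l l≤ first with lo′ , l≤lo′ , ≤hi , rest ←
    constantInterval q w H (P ∘ suc) (P? ∘ suc) (mono ∘ suc) l (≤-trans l≤ hi≤) =
    lo′ , ≤-trans lo≤l l≤lo′ , ≤-trans ≤hi (≤-trans l≤ (≤-reflexive (double lo (2 ^ q) w))) , λ where
      (suc c) → rest c
      zero    → Sum.map
        (λ f i lo≤i i≤ → f i (≤-trans l≤lo′ lo≤i) (≤-trans i≤ ≤hi))
        (λ f i lo≤i i≤ → f i (≤-trans l≤lo′ lo≤i) (≤-trans i≤ ≤hi)) first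

  left : AlwaysOrNever (P zero) lo mid → ∃[ lo′ ] Good lo′
  left = extend lo ≤-refl (m≤m+n mid v)

  right : AlwaysOrNever (P zero) mid (mid + v) → ∃[ lo′ ] Good lo′
  right = extend mid (m≤m+n lo v) ≤-refl

  choose : IncreasingOrDecreasing (P zero) H →
    Dec (P zero mid) → ∃[ lo′ ] Good lo′
  choose (inj₁ up)   (yes Pm) = right (inj₁ λ i m≤i i≤ → up mid i m≤i (≤-trans i≤ hi≤) Pm)
  choose (inj₁ up)   (no ¬Pm) = left  (inj₂ λ i _ i≤m Pi → ¬Pm (up i mid i≤m mid≤ Pi))
  choose (inj₂ down) (yes Pm) = left  (inj₁ λ i _ i≤m → down i mid i≤m mid≤ Pm)
  choose (inj₂ down) (no ¬Pm) = right (inj₂ λ i m≤i i≤ Pi → ¬Pm (down mid i m≤i (≤-trans i≤ hi≤) Pi))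

-- Lacunary sequences

DoublingUp DoublingDown Doubling : (ℕ → ℕ) → ℕ → ℕ → Set
DoublingUp   u lo hi = ∀ b c → lo ≤ b → b < c → c ≤ hi → 2 * u b ≤ u c
DoublingDown u lo hi = ∀ b c → lo ≤ b → b < c → c ≤ hi → 2 * u c ≤ u b
Doubling     u lo hi = DoublingUp u lo hi ⊎ DoublingDown u lo hi

private
  2^-step : ∀ g {x y z} → 2 * x ≤ y → 2 ^ g * y ≤ z → 2 ^ suc g * x ≤ z
  2^-step g {x} {y} {z} h h′ = begin
    2 ^ suc g * x       ≡⟨ cong (_* x) (*-comm 2 (2 ^ g)) ⟩
    2 ^ g * 2 * x       ≡⟨ *-assoc (2 ^ g) 2 x ⟩
    2 ^ g * (2 * x)     ≤⟨ *-monoʳ-≤ (2 ^ g) h ⟩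
    2 ^ g * y           ≤⟨ h′ ⟩
    z                   ∎
    where open ≤-Reasoning

doublingUp-iterate : ∀ {u lo hi} → DoublingUp u lo hi → ∀ g p → lo ≤ p → p + g ≤ hi → 2 ^ g * u p ≤ u (p + g)
doublingUp-iterate {u} up zero    p lo≤p h = ≤-reflexive (trans (*-identityˡ (u p)) (cong u (sym (+-identityʳ p))))
doublingUp-iterate {u} {lo} {hi} up (suc g) p lo≤p h = subst (λ e → 2 ^ suc g * u p ≤ u e) (sym (+-suc p g))
  (2^-step g (up p (suc p) lo≤p ≤-refl (≤-trans (m≤m+n (suc p) g) h′))
             (doublingUp-iterate up g (suc p) (m≤n⇒m≤1+n lo≤p) h′))
  where
  h′ : suc p + g ≤ hi
  h′ = subst (_≤ hi) (+-suc p g) h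

doublingDown-iterate : ∀ {u lo hi} → DoublingDown u lo hi → ∀ g p → lo ≤ p → p + g ≤ hi → 2 ^ g * u (p + g) ≤ u p
doublingDown-iterate {u} down zero    p lo≤p h = ≤-reflexive (trans (*-identityˡ (u (p + 0))) (cong u (+-identityʳ p)))
doublingDown-iterate {u} {lo} {hi} down (suc g) p lo≤p h = begin
  2 ^ suc g * u (p + suc g)     ≡⟨ cong (λ e → 2 ^ suc g * u e) (+-suc p g) ⟩
  2 ^ suc g * u (suc p + g)     ≡⟨ *-assoc 2 (2 ^ g) _ ⟩
  2 * (2 ^ g * u (suc p + g))   ≤⟨ *-monoʳ-≤ 2 (doublingDown-iterate down g (suc p) (m≤n⇒m≤1+n lo≤p) h′) ⟩
  2 * u (suc p)                 ≤⟨ down p (suc p) lo≤p ≤-refl (≤-trans (m≤m+n (suc p) g) h′) ⟩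
  u p                           ∎
  where
  open ≤-Reasoning
  h′ : suc p + g ≤ hi
  h′ = subst (_≤ hi) (+-suc p g) h

-- Whichever way the sequence grows, one end of a window of radius `g` exceeds the centre by a
-- factor `2 ^ g`. This lemma and the next one hide the direction of growth from all later
-- arguments.
larger-nearby : ∀ {u lo hi} → Doubling u lo hi → ∀ g p → lo ≤ p → p + g + g ≤ hi →
  ∃[ q ] (p ≤ q × q ≤ p + g + g × 2 ^ g * u (p + g) ≤ u q)
larger-nearby (inj₁ up)   g p lo≤p h =
  p + g + g , ≤-trans (m≤m+n p g) (m≤m+n _ g) , ≤-refl , doublingUp-iterate up g (p + g) (≤-trans lo≤p (m≤m+n p g)) h
larger-nearby (inj₂ down) g p lo≤p h =
  p , ≤-refl , ≤-trans (m≤m+n p g) (m≤m+n _ g) , doublingDown-iterate down g p lo≤p (≤-trans (m≤m+n _ g) h)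

smaller-nearby : ∀ {u lo hi} → Doubling u lo hi → ∀ g p → lo ≤ p → p + g + g ≤ hi →
  ∃[ q ] (p ≤ q × q ≤ p + g + g × 2 ^ g * u q ≤ u (p + g))
smaller-nearby (inj₁ up)   g p lo≤p h =
  p , ≤-refl , ≤-trans (m≤m+n p g) (m≤m+n _ g) , doublingUp-iterate up g p lo≤p (≤-trans (m≤m+n _ g) h)
smaller-nearby (inj₂ down) g p lo≤p h =
  p + g + g , ≤-trans (m≤m+n p g) (m≤m+n _ g) , ≤-refl , doublingDown-iterate down g (p + g) (≤-trans lo≤p (m≤m+n p g)) h

-- The two gaps share the point `b` but their lengths are arbitrary. With `D` equal to `D′` even a
-- long gap is then bounded by a short one next to it, which is the source of geometric growth.
Comparable : ℕ → (ℕ → ℕ → ℕ) → (ℕ → ℕ → ℕ) → Set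
Comparable M D D′ = (∀ {a b c} → a < b → b < c → c ≤ M → D a b ≤ D′ b c) ⊎
                    (∀ {a b c} → a < b → b < c → c ≤ M → D′ b c < D a b)

-- A sequence comparable with itself is measured from the end at which
-- its differences are small.
size : ∀ M D → Comparable M D D → ℕ → ℕ
size M D (inj₁ _) s = D 0 s
size M D (inj₂ _) s = D s M

module _ {I : Set} (M : ℕ) (D : I → ℕ → ℕ → ℕ)
  (additive : ∀ t {a b c} → a ≤ b → b ≤ c → c ≤ M → D t a c ≡ D t a b + D t b c) where

  private
    monoʳ : ∀ t {a b c} → a ≤ b → b ≤ c → c ≤ M → D t a b ≤ D t a c
    monoʳ t {a} {b} {c} a≤b b≤c c≤M = subst (D t a b ≤_) (sym (additive t a≤b b≤c c≤M)) (m≤m+n _ _)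

    monoˡ : ∀ t {a b c} → a ≤ b → b ≤ c → c ≤ M → D t b c ≤ D t a c
    monoˡ t {a} {b} {c} a≤b b≤c c≤M = subst (D t b c ≤_) (sym (additive t a≤b b≤c c≤M)) (m≤n+m _ _)

    x≤2x : ∀ x → x ≤ 2 * x
    x≤2x x = m≤m+n x (x + 0)

    2* : ∀ x → x + x ≡ 2 * x
    2* x = cong (_+_ x) (sym (+-identityʳ x))

    -- The part before `b` is at most the part after it. A distance from the end can thus be
    -- replaced by a single gap, to which comparability with other sequences applies, at the cost of
    -- a factor 2.
    rising : ∀ t (e : ∀ {a b c} → a < b → b < c → c ≤ M → D t a b ≤ D t b c) {b c} → 0 < b → b < c → c ≤ M →
      D t 0 c ≤ 2 * D t b c
    rising t e {b} {c} 0<b b<c c≤M = begin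
      D t 0 c              ≡⟨ additive t z≤n (<⇒≤ b<c) c≤M ⟩
      D t 0 b + D t b c    ≤⟨ +-monoˡ-≤ (D t b c) (e 0<b b<c c≤M) ⟩
      D t b c + D t b c    ≡⟨ 2* (D t b c) ⟩
      2 * D t b c          ∎
      where open ≤-Reasoning

    falling : ∀ t (e : ∀ {a b c} → a < b → b < c → c ≤ M → D t b c < D t a b) {a b} → a < b → b < M →
      D t a M ≤ 2 * D t a b
    falling t e {a} {b} a<b b<M = begin
      D t a M              ≡⟨ additive t (<⇒≤ a<b) (<⇒≤ b<M) ≤-refl ⟩
      D t a b + D t b M    ≤⟨ +-monoʳ-≤ (D t a b) (<⇒≤ (e a<b b<M ≤-refl)) ⟩
      D t a b + D t a b    ≡⟨ 2* (D t a b) ⟩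
      2 * D t a b          ∎
      where open ≤-Reasoning

  -- The step from `b` to `c` is compared with all that lies between `b` and the end of reference.
  -- The ends `0` and `M` are left out because only nondegenerate gaps are compared.
  size-doubling : ∀ t (e : Comparable M (D t) (D t)) {hi} → hi < M → Doubling (size M (D t) e) 1 hi
  size-doubling t (inj₁ e) hi<M = inj₁ λ b c 0<b b<c c≤hi →
    let c≤M = ≤-trans c≤hi (<⇒≤ hi<M) in begin
    2 * D t 0 b          ≡⟨ 2* (D t 0 b) ⟨
    D t 0 b + D t 0 b    ≤⟨ +-monoʳ-≤ (D t 0 b) (e 0<b b<c c≤M) ⟩
    D t 0 b + D t b c    ≡⟨ additive t z≤n (<⇒≤ b<c) c≤M ⟨
    D t 0 c              ∎
    where open ≤-Reasoning
  size-doubling t (inj₂ e) hi<M = inj₂ λ b c 0<b b<c c≤hi →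
    let c<M = ≤-<-trans c≤hi hi<M in begin
    2 * D t c M          ≡⟨ 2* (D t c M) ⟨
    D t c M + D t c M    ≤⟨ +-monoˡ-≤ (D t c M) (<⇒≤ (e b<c c<M ≤-refl)) ⟩
    D t b c + D t c M    ≡⟨ additive t (<⇒≤ b<c) (<⇒≤ c<M) ≤-refl ⟨
    D t b M              ∎
    where open ≤-Reasoning

  size-monotone : ∀ t (e : Comparable M (D t) (D t)) B → IncreasingOrDecreasing (λ s → B < size M (D t) e s) M
  size-monotone t (inj₁ e) B = inj₁ λ i j i≤j j≤M B< → <-≤-trans B< (monoʳ t z≤n i≤j j≤M)
  size-monotone t (inj₂ e) B = inj₂ λ i j i≤j j≤M B< → <-≤-trans B< (monoˡ t i≤j j≤M ≤-refl)

  -- Both sizes are reduced to gaps that meet in one point. In most cases this point is `p` or `q`,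
  -- but if the first sequence is measured from `M` and the second from `0`, it has to lie strictly
  -- between them. The point `suc p` is then used, hence the distance of at least two.
  size-comparison : ∀ t t′ (e : Comparable M (D t) (D t)) (e′ : Comparable M (D t′) (D t′)) → Comparable M (D t) (D t′) →
    (∀ p q → 0 < p → suc p < q → q < M → size M (D t) e p ≤ 2 * size M (D t′) e′ q) ⊎
    (∀ p q → 0 < p → suc p < q → q < M → size M (D t′) e′ q ≤ 2 * size M (D t) e p)
  size-comparison t t′ (inj₁ e) (inj₁ e′) (inj₁ d) = inj₁ λ p q 0<p 1+p<q q<M →
    let p<q = <-trans (n<1+n p) 1+p<q; q≤M = <⇒≤ q<M in
    ≤-trans (d 0<p p<q q≤M) (≤-trans (monoˡ t′ z≤n (<⇒≤ p<q) q≤M) (x≤2x _))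
  size-comparison t t′ (inj₁ e) (inj₁ e′) (inj₂ d) = inj₂ λ p q 0<p 1+p<q q<M →
    let p<q = <-trans (n<1+n p) 1+p<q; q≤M = <⇒≤ q<M in
    ≤-trans (rising t′ e′ 0<p p<q q≤M) (*-monoʳ-≤ 2 (<⇒≤ (d 0<p p<q q≤M)))
  size-comparison t t′ (inj₂ e) (inj₂ e′) (inj₁ d) = inj₁ λ p q 0<p 1+p<q q<M →
    let p<q = <-trans (n<1+n p) 1+p<q in
    ≤-trans (falling t e p<q q<M) (*-monoʳ-≤ 2 (d p<q q<M ≤-refl))
  size-comparison t t′ (inj₂ e) (inj₂ e′) (inj₂ d) = inj₂ λ p q 0<p 1+p<q q<M →
    let p<q = <-trans (n<1+n p) 1+p<q in
    ≤-trans (<⇒≤ (d p<q q<M ≤-refl)) (≤-trans (monoʳ t (<⇒≤ p<q) (<⇒≤ q<M) ≤-refl) (x≤2x _))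
  size-comparison t t′ (inj₁ e) (inj₂ e′) (inj₁ d) = inj₁ λ p q 0<p 1+p<q q<M →
    let p<q = <-trans (n<1+n p) 1+p<q in
    ≤-trans (monoʳ t z≤n (<⇒≤ p<q) (<⇒≤ q<M)) (≤-trans (d (<-trans 0<p p<q) q<M ≤-refl) (x≤2x _))
  size-comparison t t′ (inj₁ e) (inj₂ e′) (inj₂ d) = inj₂ λ p q 0<p 1+p<q q<M →
    let p<q = <-trans (n<1+n p) 1+p<q in
    ≤-trans (monoˡ t′ (<⇒≤ p<q) (<⇒≤ q<M) ≤-refl) (≤-trans (<⇒≤ (d 0<p (<-trans p<q q<M) ≤-refl)) (x≤2x _))
  size-comparison t t′ (inj₂ e) (inj₁ e′) (inj₁ d) = inj₁ λ p q 0<p 1+p<q q<M →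
    ≤-trans (falling t e (n<1+n p) (<-trans 1+p<q q<M))
      (*-monoʳ-≤ 2 (≤-trans (d (n<1+n p) 1+p<q (<⇒≤ q<M)) (monoˡ t′ z≤n (<⇒≤ 1+p<q) (<⇒≤ q<M))))
  size-comparison t t′ (inj₂ e) (inj₁ e′) (inj₂ d) = inj₂ λ p q 0<p 1+p<q q<M →
    ≤-trans (rising t′ e′ z<s 1+p<q (<⇒≤ q<M))
      (*-monoʳ-≤ 2 (≤-trans (<⇒≤ (d (n<1+n p) 1+p<q (<⇒≤ q<M))) (monoʳ t (n≤1+n p) (<⇒≤ (<-trans 1+p<q q<M)) ≤-refl)))

  -- One of the two positions is moved within its window to where the size is larger by `2 ^ suc g`.
  -- This gain absorbs the factor 2 of `size-comparison` and leaves `2 ^ g`.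
  size-gap : ∀ t t′ (e : Comparable M (D t) (D t)) (e′ : Comparable M (D t′) (D t′)) → Comparable M (D t) (D t′) → ∀ g →
    (∀ p q → 0 < p → suc (p + suc g + suc g) < q + suc g → q + suc g + suc g < M →
       2 ^ g * size M (D t) e (p + suc g) ≤ size M (D t′) e′ (q + suc g)) ⊎
    (∀ p q → 0 < p → suc (p + suc g) < q → q + suc g + suc g < M →
       2 ^ g * size M (D t′) e′ (q + suc g) ≤ size M (D t) e (p + suc g))
  size-gap t t′ e e′ d g = Sum.map first second (size-comparison t t′ e e′ d)
    where
    cancel-2 : ∀ {x y} → 2 ^ suc g * x ≤ 2 * y → 2 ^ g * x ≤ y
    cancel-2 {x} {y} h = *-cancelˡ-≤ 2 (≤-trans (≤-reflexive (sym (*-assoc 2 (2 ^ g) x))) h)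

    first : (∀ p q → 0 < p → suc p < q → q < M → size M (D t) e p ≤ 2 * size M (D t′) e′ q) → _
    first cmp p q 0<p hp hq
      with s , p≤s , s≤ , h ← larger-nearby
             (size-doubling t e (≤-<-trans (<⇒≤ (<-trans (n<1+n _) hp)) (≤-<-trans (m≤m+n _ (suc g)) hq)))
                                (suc g) p 0<p ≤-refl =
      cancel-2 (≤-trans h (cmp s (q + suc g) (<-≤-trans 0<p p≤s) (≤-<-trans (s≤s s≤) hp) (≤-<-trans (m≤m+n _ (suc g)) hq)))

    second : (∀ p q → 0 < p → suc p < q → q < M → size M (D t′) e′ q ≤ 2 * size M (D t) e p) → _
    second cmp p q 0<p hp hq
      with s , q≤s , s≤ , h ← larger-nearby (size-doubling t′ e′ hq) (suc g) q
             (≤-trans 0<p (≤-trans (m≤m+n p _) (<⇒≤ (<-trans (n<1+n _) hp)))) ≤-refl =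
      cancel-2 (≤-trans h (cmp (p + suc g) s (<-≤-trans 0<p (m≤m+n p _)) (<-≤-trans hp q≤s) (≤-<-trans s≤ hq)))

-- Sums with a dominant term

∣sum∣-bound : ∀ {q} (w : Fin q → ℤ) K U → (∀ b → K * ∣ w b ∣ ≤ U) → K * ∣ sum w ∣ ≤ q * U
∣sum∣-bound {zero}  w K U h = ≤-reflexive (*-zeroʳ K)
∣sum∣-bound {suc q} w K U h = begin
  K * ∣ w zero ℤ.+ sum (w ∘ suc) ∣             ≤⟨ *-monoʳ-≤ K (ℤ.∣i+j∣≤∣i∣+∣j∣ (w zero) (sum (w ∘ suc))) ⟩
  K * (∣ w zero ∣ + ∣ sum (w ∘ suc) ∣)         ≡⟨ *-distribˡ-+ K ∣ w zero ∣ _ ⟩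
  K * ∣ w zero ∣ + K * ∣ sum (w ∘ suc) ∣       ≤⟨ +-mono-≤ (h zero) (∣sum∣-bound (w ∘ suc) K U (h ∘ suc)) ⟩
  U + q * U                                    ∎
  where open ≤-Reasoning

0<i+j : ∀ i j → 0ℤ ℤ.< i → ∣ j ∣ < ∣ i ∣ → 0ℤ ℤ.< i ℤ.+ j
0<i+j (+ suc a) (+ b)    _ _ = ℤ.+<+ z<s
0<i+j (+ suc a) -[1+ b ] _ h = subst (0ℤ ℤ.<_) (sym (ℤ.⊖-≥ (<⇒≤ h))) (ℤ.+<+ (m<n⇒0<n∸m h))
0<i+j (+ zero)  j (ℤ.+<+ ()) _

module _ (w R : ℤ) (r : ℕ) (R≪w : suc r * ∣ R ∣ ≤ r * ∣ w ∣) where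

  private
    ∣R∣<∣w∣ : w ≢ 0ℤ → ∣ R ∣ < ∣ w ∣
    ∣R∣<∣w∣ w≢0 = ≰⇒> λ ∣w∣≤∣R∣ → <⇒≱ (*-monoˡ-< ∣ w ∣ {{≢-nonZero (w≢0 ∘ ℤ.∣i∣≡0⇒i≡0)}} (n<1+n r))
      (≤-trans (*-monoʳ-≤ (suc r) ∣w∣≤∣R∣) R≪w)

  dominant⇒sign⁺ : 0ℤ ℤ.< w → 0ℤ ℤ.< w ℤ.+ R
  dominant⇒sign⁺ 0<w = 0<i+j w R 0<w (∣R∣<∣w∣ (ℤ.<⇒≢ 0<w ∘ sym))

  -- The bound also covers a vanishing `w`, where it forces `R` to vanish; otherwise both terms are
  -- negated and `0<i+j` applies.
  dominant⇒sign⁻ : w ℤ.≤ 0ℤ → w ℤ.+ R ℤ.≤ 0ℤ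
  dominant⇒sign⁻ w≤0 with w ℤ.≟ 0ℤ
  ... | yes refl = ℤ.≤-reflexive (trans (ℤ.+-identityˡ R)
    (ℤ.∣i∣≡0⇒i≡0 (m*n≡0⇒n≡0 (suc r) _ (n≤0⇒n≡0 (≤-trans R≪w (≤-reflexive (*-zeroʳ r)))))))
    where
    m*n≡0⇒n≡0 : ∀ m n .{{_ : NonZero m}} → m * n ≡ 0 → n ≡ 0
    m*n≡0⇒n≡0 m n h = *-cancelˡ-≡ n 0 m (trans h (sym (*-zeroʳ m)))
  ... | no w≢0 = ℤ.<⇒≤ (ℤ.neg-cancel-< (subst (0ℤ ℤ.<_) (sym (ℤ.neg-distrib-+ w R))
    (0<i+j (ℤ.- w) (ℤ.- R) (ℤ.neg-mono-< (ℤ.≤∧≢⇒< w≤0 w≢0))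
      (subst₂ _<_ (sym (ℤ.∣-i∣≡∣i∣ R)) (sym (ℤ.∣-i∣≡∣i∣ w)) (∣R∣<∣w∣ w≢0)))))

-- Domination by a factor is not reflexive: a nonzero summand does not dominate itself. This is why
-- the maximum is compared with the other elements only.
maximum : ∀ {q} (_≼_ : Fin (suc q) → Fin (suc q) → Set) →
  (∀ {a b c} → a ≼ b → b ≼ c → a ≼ c) → (∀ a b → a Fin.< b → a ≼ b ⊎ b ≼ a) →
  ∃[ l ] (∀ b → b ≢ l → b ≼ l)
maximum {zero}  _≼_ tr total = zero , λ { zero 0≢0 → contradiction refl 0≢0 }
maximum {suc q} _≼_ tr total
  with l , max ← maximum (λ a b → suc a ≼ suc b) tr (λ a b a<b → total (suc a) (suc b) (s≤s a<b))
  with total zero (suc l) z<s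
... | inj₁ 0≼l = suc l , λ where
  zero    _   → 0≼l
  (suc b) b≢l → max b (b≢l ∘ cong suc)
... | inj₂ l≼0 = zero , λ where
  zero    0≢0 → contradiction refl 0≢0
  (suc b) _   → case b Fin.≟ l of λ where
    (yes refl) → l≼0
    (no b≢l)   → tr (max b b≢l) l≼0

module _ {r : ℕ} {I : Set} (w : I → Fin (suc r) → ℤ) (B : ℤ) where

  private
    -- At most `suc r` terms compete with the dominant one: the other `r` summands and `B`, or all
    -- summands if `B` dominates. The factor exceeds their number by one, so together they stay
    -- strictly below a nonzero dominant term.
    K : ℕ
    K = suc (suc r)

    S : I → ℤ
    S i = sum (w i)

    B<⇒0<- : ∀ {i} → B ℤ.< i → 0ℤ ℤ.< i ℤ.- B
    B<⇒0<- {i} h = subst (ℤ._< i ℤ.- B) (ℤ.+-inverseʳ B) (ℤ.+-monoˡ-< (ℤ.- B) h)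

    0<-⇒B< : ∀ {i} → 0ℤ ℤ.< i ℤ.- B → B ℤ.< i
    0<-⇒B< {i} h = subst₂ ℤ._<_ (ℤ.+-identityˡ B) (cancel i B) (ℤ.+-monoˡ-< B h)
      where
      cancel : ∀ i b → i ℤ.- b ℤ.+ b ≡ i
      cancel = ℤ-Solver.solve-∀

    -- The quantifier over `i` makes the order, and with it the dominant summand, common to all
    -- tuples.
    _≼_ : Fin (suc r) → Fin (suc r) → Set
    a ≼ b = ∀ i → K * ∣ w i a ∣ ≤ ∣ w i b ∣

    ≼-trans : ∀ {a b c} → a ≼ b → b ≼ c → a ≼ c
    ≼-trans a≼b b≼c i = ≤-trans (a≼b i) (≤-trans (m≤m+n _ _) (b≼c i))

  Constant> : Set
  Constant> = (∀ i → B ℤ.< sum (w i)) ⊎ (∀ i → ¬ B ℤ.< sum (w i))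

  -- It suffices to compare `B` with the largest summand. The clause `0 < ∣ w i a ∣` matters for `B`
  -- zero: a dominant summand that vanished for some `i` and was positive for others would give sums
  -- both equal to `B` and above it.
  dominated⇒constant :
    (∀ a b → a Fin.< b → (∀ i → K * ∣ w i a ∣ ≤ ∣ w i b ∣) ⊎ (∀ i → K * ∣ w i b ∣ ≤ ∣ w i a ∣)) →
    (∀ a → (∀ i → K * ∣ B ∣ ≤ ∣ w i a ∣ × 0 < ∣ w i a ∣) ⊎ (∀ i → K * ∣ w i a ∣ ≤ ∣ B ∣)) →
    (∀ a → (∀ i → 0ℤ ℤ.≤ w i a) ⊎ (∀ i → w i a ℤ.≤ 0ℤ)) →
    Constant>
  dominated⇒constant pairs bound signs with maximum _≼_ (λ {a} {b} {c} → ≼-trans {a} {b} {c}) pairs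
  ... | l , max with bound l | signs l
  ...   | inj₁ big | sgn = Sum.map positive negative sgn
    where
    R : I → ℤ
    R i = sum (removeAt (w i) l) ℤ.- B

    split : ∀ i → S i ℤ.- B ≡ w i l ℤ.+ R i
    split i = trans (cong (ℤ._- B) (sum-remove {i = l} (w i))) (ℤ.+-assoc (w i l) _ _)

    R≪w : ∀ i → K * ∣ R i ∣ ≤ suc r * ∣ w i l ∣
    R≪w i = begin
      K * ∣ R i ∣                                             ≤⟨ *-monoʳ-≤ K (ℤ.∣i-j∣≤∣i∣+∣j∣ (sum (removeAt (w i) l)) B) ⟩
      K * (∣ sum (removeAt (w i) l) ∣ + ∣ B ∣)                ≡⟨ *-distribˡ-+ K ∣ sum (removeAt (w i) l) ∣ ∣ B ∣ ⟩
      K * ∣ sum (removeAt (w i) l) ∣ + K * ∣ B ∣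
        ≤⟨ +-mono-≤ (∣sum∣-bound (removeAt (w i) l) K ∣ w i l ∣ λ b → max (punchIn l b) (Fin.punchInᵢ≢i l b) i)
                    (proj₁ (big i)) ⟩
      r * ∣ w i l ∣ + ∣ w i l ∣                               ≡⟨ +-comm (r * ∣ w i l ∣) _ ⟩
      suc r * ∣ w i l ∣                                       ∎
      where open ≤-Reasoning

    positive : (∀ i → 0ℤ ℤ.≤ w i l) → ∀ i → B ℤ.< S i
    positive 0≤w i = 0<-⇒B< (subst (0ℤ ℤ.<_) (sym (split i)) (dominant⇒sign⁺ (w i l) (R i) (suc r) (R≪w i)
      (ℤ.≤∧≢⇒< (0≤w i) λ 0≡w → <-irrefl (cong ∣_∣ 0≡w) (proj₂ (big i)))))

    negative : (∀ i → w i l ℤ.≤ 0ℤ) → ∀ i → ¬ B ℤ.< S i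
    negative w≤0 i B<S = ℤ.<⇒≱ (B<⇒0<- B<S) (subst (ℤ._≤ 0ℤ) (sym (split i))
      (dominant⇒sign⁻ (w i l) (R i) (suc r) (R≪w i) (w≤0 i)))
  ...   | inj₂ small | _ = case 0ℤ ℤ.<? ℤ.- B of λ where
      (yes 0<-B) → inj₁ λ i → 0<-⇒B< (subst (0ℤ ℤ.<_) (ℤ.+-comm (ℤ.- B) (S i))
        (dominant⇒sign⁺ (ℤ.- B) (S i) (suc r) (S≪B i) 0<-B))
      (no ¬0<-B) → inj₂ λ i B<S → ℤ.<⇒≱ (B<⇒0<- B<S) (subst (ℤ._≤ 0ℤ) (ℤ.+-comm (ℤ.- B) (S i))
        (dominant⇒sign⁻ (ℤ.- B) (S i) (suc r) (S≪B i) (ℤ.≮⇒≥ ¬0<-B)))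
    where
    S≪B : ∀ i → K * ∣ S i ∣ ≤ suc r * ∣ ℤ.- B ∣
    S≪B i = subst (λ b → K * ∣ S i ∣ ≤ suc r * b) (sym (ℤ.∣-i∣≡∣i∣ B)) (∣sum∣-bound (w i) K ∣ B ∣ all)
      where
      all : ∀ b → K * ∣ w i b ∣ ≤ ∣ B ∣
      all b with b Fin.≟ l
      ... | yes refl = small i
      ... | no b≢l   = ≤-trans (max b b≢l i) (≤-trans (m≤m+n _ _) (small i))

-- From integer sequences to lacunary ones

private
  transfer : {P Q : Set} (P? : Dec P) (Q? : Dec Q) → ⌊ P? ⌋ ≡ ⌊ Q? ⌋ → P → Q
  transfer _        (yes q) _  _ = q
  transfer (yes _)  (no _)  ()
  transfer (no ¬p)  (no _)  _  p = contradiction p ¬p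

dist : ℤ → ℤ → ℕ
dist a b = ∣ b ℤ.- a ∣

dist-additive : ∀ {a b c} → a ℤ.≤ b → b ℤ.≤ c → dist a c ≡ dist a b + dist b c
dist-additive {a} {b} {c} a≤b b≤c = begin
  ∣ c ℤ.- a ∣                                        ≡⟨ cong ∣_∣ (telescope a b c) ⟩
  ∣ (b ℤ.- a) ℤ.+ (c ℤ.- b) ∣                        ≡⟨ cong ∣_∣ (cong₂ ℤ._+_ (gap a≤b) (gap b≤c)) ⟩
  ∣ + dist a b ℤ.+ + dist b c ∣                      ≡⟨⟩
  dist a b + dist b c                                ∎
  where
  open ≡-Reasoning
  telescope : ∀ a b c → c ℤ.- a ≡ (b ℤ.- a) ℤ.+ (c ℤ.- b)
  telescope = ℤ-Solver.solve-∀

  gap : ∀ {a b} → a ℤ.≤ b → b ℤ.- a ≡ + ∣ b ℤ.- a ∣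
  gap a≤b = sym (ℤ.0≤i⇒+∣i∣≡i (ℤ.i≤j⇒0≤j-i a≤b))

dist-sym : ∀ a b → dist a b ≡ dist b a
dist-sym a b = ℤ.∣i-j∣≡∣j-i∣ b a

dist-additive′ : ∀ {a b c} → b ℤ.≤ a → c ℤ.≤ b → dist a c ≡ dist a b + dist b c
dist-additive′ {a} {b} {c} b≤a c≤b = begin
  dist a c              ≡⟨ dist-sym a c ⟩
  dist c a              ≡⟨ dist-additive c≤b b≤a ⟩
  dist c b + dist b a   ≡⟨ +-comm (dist c b) (dist b a) ⟩
  dist b a + dist c b   ≡⟨ cong₂ _+_ (dist-sym b a) (dist-sym c b) ⟩
  dist a b + dist b c   ∎
  where open ≡-Reasoning

nth : List ℕ → ℕ → ℕ
nth []       _       = 0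
nth (x ∷ xs) zero    = x
nth (x ∷ xs) (suc i) = nth xs i

nth-∈ : ∀ xs {i} → i < length xs → nth xs i ∈ xs
nth-∈ (x ∷ xs) {zero}  _       = here refl
nth-∈ (x ∷ xs) {suc i} (s≤s h) = there (nth-∈ xs h)

nth-mono-< : ∀ {xs} → AllPairs _<_ xs → ∀ {i j} → i < j → j < length xs → nth xs i < nth xs j
nth-mono-< {x ∷ xs} (x< ∷ _)  {zero}  {suc j} _         (s≤s h) = All.lookup x< (nth-∈ xs h)
nth-mono-< {x ∷ xs} (_ ∷ xs<) {suc i} {suc j} (s≤s i<j) (s≤s h) = nth-mono-< xs< i<j h

Monotone : (ℕ → ℤ) → ℕ → Set
Monotone y L = (∀ i j → i < j → j ≤ L → y i ℤ.≤ y j) ⊎ (∀ i j → i < j → j ≤ L → y j ℤ.≤ y i)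

-- The factor `2 ^ k` pays for giving each of the `k` sequences a direction, and `suc L` counts the
-- positions from `0` to `L`.
treeLength : ℕ → ℕ → ℕ
treeLength k L = 2 ^ k * suc L

-- The tests are `k * k` comparisons of gaps and `k` comparisons of values. Each is specialised at
-- every level, so the tree length enters the exponent twice.
treeSize : ℕ → ℕ → ℕ
treeSize k L = 2 ^ (suc (treeLength k L * (k * k + k)) * treeLength k L)

module _ (k N : ℕ) (x : Fin k → Fin N → ℤ) where

  private
    δ : Fin k → Fin N → Fin N → ℕ
    δ t a b = dist (x t a) (x t b)

    compare? : (tt′ : Fin k × Fin k) → ∀ a b c → Dec (δ (proj₁ tt′) a b ≤ δ (proj₂ tt′) b c)
    compare? (t , t′) a b c = δ t a b ≤? δ t′ b c

    rises? : ∀ t a b → Dec (x t a ℤ.≤ x t b)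
    rises? t a b = x t a ℤ.≤? x t b

    comparisons rises : List (Fin N → Fin N → Fin N → Bool)
    comparisons = List.tabulate {n = k * k} λ c a b b′ → ⌊ compare? (remQuot k c) a b b′ ⌋
    rises       = List.tabulate {n = k} λ t a _ b → ⌊ rises? t a b ⌋

    #tests : length (comparisons ++ rises) ≡ k * k + k
    #tests = trans (List.length-++ comparisons) (cong₂ _+_
      (List.length-tabulate λ c a b b′ → ⌊ compare? (remQuot k c) a b b′ ⌋)
      (List.length-tabulate λ t a _ b → ⌊ rises? t a b ⌋))

  monotoneSubsequence : ∀ L → treeSize k L ≤ N →
    ∃[ e ] ((∀ i j → i < j → j ≤ L → e i Fin.< e j) ×
            (∀ t → Monotone (x t ∘ e) L) ×
            (∀ t t′ {i j l l′} → i < j → j < l → l ≤ L → j < l′ → l′ ≤ L →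
              dist (x t (e i)) (x t (e j)) ≤ dist (x t′ (e j)) (x t′ (e l)) →
              dist (x t (e i)) (x t (e j)) ≤ dist (x t′ (e j)) (x t′ (e l′))))
  monotoneSubsequence L h
    with z , _ , z< , _ , τs ← erdősRado {_<ₐ_ = Fin._<_} (comparisons ++ rises)
           (treeLength k L * (k * k + k)) (treeLength k L) [] (List.allFin N)
           (AllPairs.tabulate⁺-< λ i<j → i<j)
           (≤-reflexive (cong (treeLength k L *_) #tests))
           (≤-trans h (≤-reflexive (sym (List.length-tabulate {n = N} (λ i → i)))))
    with ys , ys⊆ , len , consts ← constantSublist
           -- Whether `x t` rises from one term to a later one depends on the earlier term alone, so
           -- the last term serves as a reference. Terms that agree on this form a monotone
           -- sequence.
           (List.tabulate λ t i → ⌊ rises? t (z i) (z (pred (treeLength k L))) ⌋)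
           (List.upTo (treeLength k L)) (suc L)
           (≤-reflexive (trans (cong (λ a → 2 ^ a * suc L) (List.length-tabulate {n = k} _))
                               (sym (List.length-upTo (treeLength k L))))) =
    e , (λ i j i<j j≤L → z< (at< i<j j≤L) (at<Len j≤L)) , monotone , gaps
    where
    at : ℕ → ℕ
    at = nth ys

    e : ℕ → Fin N
    e = z ∘ at

    last : ℕ
    last = pred (treeLength k L)

    at∈ : ∀ {i} → i ≤ L → at i ∈ ys
    at∈ i≤L = nth-∈ ys (≤-trans (s≤s i≤L) len)

    at<Len : ∀ {i} → i ≤ L → at i < treeLength k L
    at<Len i≤L = List.∈-upTo⁻ (Sublist.lookup ys⊆ (at∈ i≤L))

    at< : ∀ {i j} → i < j → j ≤ L → at i < at j
    at< i<j j≤L = nth-mono-<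
      (AllPairs-resp-⊆ ys⊆ (AllPairs.applyUpTo⁺₁ _ (treeLength k L) λ i<j _ → i<j))
      i<j (≤-trans (s≤s j≤L) len)

    last<Len : last < treeLength k L
    last<Len = ≤-reflexive (suc-pred (treeLength k L) {{m*n≢0 (2 ^ k) (suc L) {{m^n≢0 2 k}}}})

    at<last : ∀ {i j} → i < j → j ≤ L → at i < last
    at<last i<j j≤L = <-≤-trans (at< i<j j≤L) (pred-mono-≤ (at<Len j≤L))

    gaps : ∀ t t′ {i j l l′} → i < j → j < l → l ≤ L → j < l′ → l′ ≤ L →
      δ t (e i) (e j) ≤ δ t′ (e j) (e l) → δ t (e i) (e j) ≤ δ t′ (e j) (e l′)
    gaps t t′ {i} {j} {l} {l′} i<j j<l l≤L j<l′ l′≤L = transfer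
      (compare? (t , t′) (e i) (e j) (e l)) (compare? (t , t′) (e i) (e j) (e l′))
      (subst (λ tt′ → ⌊ compare? tt′ (e i) (e j) (e l) ⌋ ≡ ⌊ compare? tt′ (e i) (e j) (e l′) ⌋)
        (Fin.remQuot-combine t t′)
        (All.tabulate⁻ (All.++⁻ˡ comparisons τs) (combine t t′) (at i) (at j) (at l) (at l′)
          (<⇒≤ (at< i<j (<⇒≤ (<-≤-trans j<l l≤L)))) (at< j<l l≤L) (at<Len l≤L) (at< j<l′ l′≤L) (at<Len l′≤L)))

    toLast : ∀ t {i j} → i < j → j ≤ L → ⌊ rises? t (e i) (z last) ⌋ ≡ ⌊ rises? t (e i) (e j) ⌋
    -- The test ignores its middle argument, which is set equal to the first.
    toLast t {i} {j} i<j j≤L = All.tabulate⁻ (All.++⁻ʳ comparisons τs) t (at i) (at i) last (at j)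
      ≤-refl (at<last i<j j≤L) last<Len (at< i<j j≤L) (at<Len j≤L)

    const-rise : ∀ t {i j} → i ≤ L → j ≤ L → ⌊ rises? t (e i) (z last) ⌋ ≡ ⌊ rises? t (e j) (z last) ⌋
    const-rise t i≤L j≤L = All.tabulate⁻ consts t _ _ (at∈ i≤L) (at∈ j≤L)

    monotone : ∀ t → Monotone (x t ∘ e) L
    monotone t = case rises? t (e 0) (z last) of λ where
      (yes up) → inj₁ λ i j i<j j≤L →
        transfer (rises? t (e i) (z last)) (rises? t (e i) (e j)) (toLast t i<j j≤L)
          (transfer (rises? t (e 0) (z last)) (rises? t (e i) (z last)) (const-rise t z≤n (<⇒≤ (<-≤-trans i<j j≤L))) up)
      (no ¬up) → inj₂ λ i j i<j j≤L → ℤ.<⇒≤ (ℤ.≰⇒> λ xi≤xj → ¬up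
        (transfer (rises? t (e i) (z last)) (rises? t (e 0) (z last)) (const-rise t (<⇒≤ (<-≤-trans i<j j≤L)) z≤n)
          (transfer (rises? t (e i) (e j)) (rises? t (e i) (z last)) (sym (toLast t i<j j≤L)) xi≤xj)))

gaps : (ℕ → ℤ) → ℕ → ℕ → ℕ
gaps y a b = dist (y a) (y b)

gaps-additive : ∀ {y L} → Monotone y L → ∀ {a b c} → a ≤ b → b ≤ c → c ≤ L →
  gaps y a c ≡ gaps y a b + gaps y b c
gaps-additive {y} {L} mono {a} {b} {c} a≤b b≤c c≤L = case mono of λ where
    (inj₁ up)   → dist-additive (weaken ℤ._≤_ ℤ.≤-refl up a≤b (≤-trans b≤c c≤L)) (weaken ℤ._≤_ ℤ.≤-refl up b≤c c≤L)
    (inj₂ down) → dist-additive′ (weaken ℤ._≥_ ℤ.≤-refl down a≤b (≤-trans b≤c c≤L)) (weaken ℤ._≥_ ℤ.≤-refl down b≤c c≤L)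
  where
  weaken : ∀ (R : ℤ → ℤ → Set) → (∀ {i} → R i i) → (∀ i j → i < j → j ≤ L → R (y i) (y j)) →
    ∀ {i j} → i ≤ j → j ≤ L → R (y i) (y j)
  weaken R R-refl h {i} {j} i≤j j≤L with m≤n⇒m<n∨m≡n i≤j
  ... | inj₁ i<j  = h i j i<j j≤L
  ... | inj₂ refl = R-refl

gaps-sub : ∀ {y L} → Monotone y L → ∀ {i i′ j′ j} → i ≤ i′ → i′ ≤ j′ → j′ ≤ j → j ≤ L →
  gaps y i′ j′ ≤ gaps y i j
gaps-sub {y} mono {i} {i′} {j′} {j} i≤i′ i′≤j′ j′≤j j≤L = begin
  gaps y i′ j′                  ≤⟨ m≤n+m (gaps y i′ j′) (gaps y i i′) ⟩
  gaps y i i′ + gaps y i′ j′    ≡⟨ gaps-additive mono i≤i′ i′≤j′ (≤-trans j′≤j j≤L) ⟨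
  gaps y i j′                   ≤⟨ m≤m+n (gaps y i j′) (gaps y j′ j) ⟩
  gaps y i j′ + gaps y j′ j     ≡⟨ gaps-additive mono (≤-trans i≤i′ i′≤j′) j′≤j j≤L ⟨
  gaps y i j                    ∎
  where open ≤-Reasoning

module _ (k : ℕ) (y : Fin k → ℕ → ℤ) (M L : ℕ) .{{_ : NonZero M}} (M^≤L : M ^ suc (k * k) ≤ L)
  (mono : ∀ t → Monotone (y t) L)
  (determined : ∀ t t′ {i j l l′} → i < j → j < l → l ≤ L → j < l′ → l′ ≤ L →
    gaps (y t) i j ≤ gaps (y t′) j l → gaps (y t) i j ≤ gaps (y t′) j l′)
  where

  private
    -- By `determined`, the third point may be fixed at the far end `L`. Shrinking the interval from
    -- `i` to `j` then lowers the left side and raises the right side, and this is what makes the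
    -- relation pass to subintervals.
    Left : Fin k × Fin k → ℕ → ℕ → Set
    Left (t , t′) i j = gaps (y t) i j ≤ gaps (y t′) j L

    closed : ∀ tt′ {i i′ j′ j} → i ≤ i′ → i′ < j′ → j′ ≤ j → j ≤ L → Left tt′ i j → Left tt′ i′ j′
    closed (t , t′) i≤i′ i′<j′ j′≤j j≤L g =
      ≤-trans (gaps-sub (mono t) i≤i′ (<⇒≤ i′<j′) j′≤j j≤L) (≤-trans g (gaps-sub (mono t′) j′≤j j≤L ≤-refl ≤-refl))

    module _ (start d : ℕ) (0<d : 0 < d) (≤L : start + M * d ≤ L) where

      p : ℕ → ℕ
      p s = start + s * d

      p< : ∀ {i j} → i < j → p i < p j
      p< i<j = +-monoʳ-< start (*-monoˡ-< d {{>-nonZero 0<d}} i<j)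

      p≤ : ∀ {j} → j ≤ M → p j ≤ L
      p≤ j≤M = ≤-trans (+-monoʳ-≤ start (*-monoˡ-≤ d j≤M)) ≤L

      Homogeneous : Fin k × Fin k → Set
      Homogeneous tt′ = (∀ a b → a < b → b ≤ M → Left tt′ (p a) (p b)) ⊎
                        (∀ a b → a < b → b ≤ M → ¬ Left tt′ (p a) (p b))

      comparable : ∀ t t′ → Homogeneous (t , t′) → Comparable M (gaps (y t ∘ p)) (gaps (y t′ ∘ p))
      comparable t t′ (inj₁ h) = inj₁ λ {a} {b} {c} a<b b<c c≤M →
        determined t t′ (p< a<b) (<-≤-trans (p< b<c) (p≤ c≤M)) ≤-refl (p< b<c) (p≤ c≤M)
          (h a b a<b (<⇒≤ (<-≤-trans b<c c≤M)))
      comparable t t′ (inj₂ h) = inj₂ λ {a} {b} {c} a<b b<c c≤M → ≰⇒> λ g →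
        h a b a<b (<⇒≤ (<-≤-trans b<c c≤M))
          (determined t t′ (p< a<b) (p< b<c) (p≤ c≤M) (<-≤-trans (p< b<c) (p≤ c≤M)) ≤-refl g)

  comparableProgression :
    ∃[ f ] ((∀ i j → i < j → j ≤ M → f i < f j) × (∀ j → j ≤ M → f j ≤ L) ×
            (∀ t t′ → Comparable M (gaps (y t ∘ f)) (gaps (y t′ ∘ f))))
  comparableProgression = conclude
    (homogeneousProgression (k * k) M L (Left ∘ remQuot k) (λ _ _ _ → _ ≤? _) (closed ∘ remQuot k) 0 M^≤L)
    where
    conclude : ∃[ start ] ∃[ d ] (0 < d × 0 ≤ start × start + M * d ≤ M ^ suc (k * k) ×
      (∀ c → (∀ a b → a < b → b ≤ M → Left (remQuot k c) (start + a * d) (start + b * d)) ⊎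
             (∀ a b → a < b → b ≤ M → ¬ Left (remQuot k c) (start + a * d) (start + b * d)))) → _
    conclude (start , d , 0<d , _ , hi , hom) =
      p start d 0<d ≤L , (λ _ _ i<j _ → p< start d 0<d ≤L i<j) , (λ _ → p≤ start d 0<d ≤L) ,
      λ t t′ → comparable start d 0<d ≤L t t′
        (subst (Homogeneous start d 0<d ≤L) (Fin.remQuot-combine t t′) (hom (combine t t′)))
      where
      ≤L = ≤-trans hi M^≤L

lacunarySubsequence : ∀ k N (x : Fin k → Fin N → ℤ) M .{{_ : NonZero M}} →
  treeSize k (M ^ suc (k * k)) ≤ N →
  ∃[ f ] ((∀ i j → i < j → j ≤ M → f i Fin.< f j) × (∀ t → Monotone (x t ∘ f) M) ×
          (∀ t t′ → Comparable M (gaps (x t ∘ f)) (gaps (x t′ ∘ f))))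
lacunarySubsequence k N x M h = conclude (monotoneSubsequence k N x L h)
  where
  L = M ^ suc (k * k)

  conclude : ∃[ e ] ((∀ i j → i < j → j ≤ L → e i Fin.< e j) × (∀ t → Monotone (x t ∘ e) L) ×
    (∀ t t′ {i j l l′} → i < j → j < l → l ≤ L → j < l′ → l′ ≤ L →
      gaps (x t ∘ e) i j ≤ gaps (x t′ ∘ e) j l → gaps (x t ∘ e) i j ≤ gaps (x t′ ∘ e) j l′)) → _
  conclude (e , e< , mono , determined) =
    compose (comparableProgression k (λ t → x t ∘ e) M L ≤-refl mono determined)
    where
    compose : ∃[ f ] ((∀ i j → i < j → j ≤ M → f i < f j) × (∀ j → j ≤ M → f j ≤ L) ×
      (∀ t t′ → Comparable M (gaps (x t ∘ e ∘ f)) (gaps (x t′ ∘ e ∘ f)))) → _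
    compose (f , f< , f≤ , cmp) =
      e ∘ f ,
      (λ i j i<j j≤M → e< (f i) (f j) (f< i j i<j j≤M) (f≤ j j≤M)) ,
      (λ t → Sum.map (λ up i j i<j j≤M → up (f i) (f j) (f< i j i<j j≤M) (f≤ j j≤M))
                     (λ down i j i<j j≤M → down (f i) (f j) (f< i j i<j j≤M) (f≤ j j≤M)) (mono t)) ,
      cmp

-- Sparse positions

module _ (y : ℕ → ℤ) (M : ℕ) where

  base : Comparable M (gaps y) (gaps y) → ℤ
  base (inj₁ _) = y 0
  base (inj₂ _) = y M

  ∣y-base∣≡size : ∀ e s → ∣ y s ℤ.- base e ∣ ≡ size M (gaps y) e s
  ∣y-base∣≡size (inj₁ _) s = refl
  ∣y-base∣≡size (inj₂ _) s = ℤ.∣i-j∣≡∣j-i∣ (y s) (y M)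

  y-base-sign : Monotone y M → ∀ e →
    (∀ s → 0 < s → s < M → 0ℤ ℤ.≤ y s ℤ.- base e) ⊎ (∀ s → 0 < s → s < M → y s ℤ.- base e ℤ.≤ 0ℤ)
  y-base-sign (inj₁ up)   (inj₁ _) = inj₁ λ s 0<s s<M → ℤ.i≤j⇒0≤j-i (up 0 s 0<s (<⇒≤ s<M))
  y-base-sign (inj₁ up)   (inj₂ _) = inj₂ λ s 0<s s<M → ℤ.i≤j⇒i-j≤0 (up s M s<M ≤-refl)
  y-base-sign (inj₂ down) (inj₁ _) = inj₂ λ s 0<s s<M → ℤ.i≤j⇒i-j≤0 (down 0 s 0<s (<⇒≤ s<M))
  y-base-sign (inj₂ down) (inj₂ _) = inj₁ λ s 0<s s<M → ℤ.i≤j⇒0≤j-i (down s M s<M ≤-refl)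

-- Positions are the centres of windows of radius `suc g`. The centre of one window lies two before
-- the start of the next, as `size-comparison` requires. Windows may overlap, since only one of two
-- positions is moved at a time.
spacing : ℕ → ℕ
spacing g = suc (suc (suc g))

-- The factor `2 ^ q` is spent by `constantInterval`, the block beyond `n` holds the part of the
-- last window that protrudes, and the additional 2 keeps the interval strictly between the ends `0`
-- and `M`.
room : ℕ → ℕ → ℕ → ℕ
room q n g = suc (suc (2 ^ q * (suc n * spacing g)))

module _ {k h : ℕ} (n g K : ℕ) (K≤ : K ≤ 2 ^ g) (D : Fin k → ℕ → ℕ → ℕ)
  (additive : ∀ t {a b c} → a ≤ b → b ≤ c → c ≤ room (k * h) n g → D t a c ≡ D t a b + D t b c)
  (cmp : ∀ t t′ → Comparable (room (k * h) n g) (D t) (D t′))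
  (β : Fin k → Fin h → ℕ)
  where

  private
    M : ℕ
    M = room (k * h) n g

    S : Fin k → ℕ → ℕ
    S t = size M (D t) (cmp t t)

    Exceeds : Fin k × Fin h → ℕ → Set
    Exceeds (t , c) s = β t c < S t s

    w : ℕ
    w = suc n * spacing g

    module _ (lo : ℕ) (0<lo : 0 < lo) (lo+w<M : lo + w < M) where

      p at : ℕ → ℕ
      p v   = lo + v * spacing g
      at v = p v + suc g

      0<p : ∀ v → 0 < p v
      0<p v = ≤-trans 0<lo (m≤m+n lo _)

      p-step : ∀ {i j} → i < j → suc (suc (p i + suc g)) ≤ p j
      p-step {i} {j} i<j = begin
        suc (suc (p i + suc g))              ≡⟨ rearrange lo i g ⟩
        lo + suc i * spacing g               ≤⟨ +-monoʳ-≤ lo (*-monoˡ-≤ (spacing g) i<j) ⟩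
        p j                                  ∎
        where
        open ≤-Reasoning
        rearrange : ∀ lo i g → suc (suc (lo + i * suc (suc (suc g)) + suc g)) ≡ lo + suc i * suc (suc (suc g))
        rearrange = solve-∀

      at-step : ∀ {i j} → i < j → suc (p i + suc g + suc g) < p j + suc g
      at-step i<j = +-monoˡ-≤ (suc g) (p-step i<j)

      p≤ : ∀ {v} → v < n → p v + suc g + suc g ≤ lo + w
      p≤ {v} v<n = begin
        p v + suc g + suc g                        ≤⟨ m≤m+n _ 4 ⟩
        p v + suc g + suc g + 4                    ≡⟨ rearrange lo v g ⟩
        lo + suc (suc v) * spacing g               ≤⟨ +-monoʳ-≤ lo (*-monoˡ-≤ (spacing g) (s≤s v<n)) ⟩
        lo + w                                     ∎
        where
        open ≤-Reasoning
        rearrange : ∀ lo v g → lo + v * suc (suc (suc g)) + suc g + suc g + 4 ≡ lo + suc (suc v) * suc (suc (suc g))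
        rearrange = solve-∀

      p<M : ∀ {v} → v < n → p v + suc g + suc g < M
      p<M v<n = ≤-<-trans (p≤ v<n) lo+w<M

      K*≤ : ∀ {a b} → 2 ^ g * a ≤ b → K * a ≤ b
      K*≤ {a} = ≤-trans (*-monoˡ-≤ a K≤)

      K*≤′ : ∀ {a b} → 2 ^ suc g * a ≤ b → K * a ≤ b
      K*≤′ {a} = ≤-trans (*-monoˡ-≤ a (≤-trans K≤ (m≤m+n (2 ^ g) _)))

      gap : ∀ t t′ →
        (∀ i j → i < j → j < n → K * S t (at i) ≤ S t′ (at j)) ⊎
        (∀ i j → i < j → j < n → K * S t′ (at j) ≤ S t (at i))
      gap t t′ = Sum.map
        (λ f i j i<j j<n → K*≤ (f (p i) (p j) (0<p i) (at-step i<j) (p<M j<n)))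
        (λ f i j i<j j<n → K*≤ (f (p i) (p j) (0<p i) (p-step i<j) (p<M j<n)))
        (size-gap M D additive t t′ (cmp t t) (cmp t′ t′) (cmp t t′) g)

      nearby : ∀ {v q} → v < n → p v ≤ q → q ≤ p v + suc g + suc g → lo ≤ q × q ≤ lo + w
      nearby v<n p≤q q≤ = ≤-trans (m≤m+n lo _) p≤q , ≤-trans q≤ (p≤ v<n)

      -- The size does not cross `β t c` within the interval, so the comparison holds at both ends
      -- of the window. The growth between the centre and the suitable end turns it into domination
      -- at the centre.
      threshold : ∀ t c → AlwaysOrNever (Exceeds (t , c)) lo (lo + w) →
        (∀ i → i < n → K * β t c ≤ S t (at i) × 0 < S t (at i)) ⊎ (∀ i → i < n → K * S t (at i) ≤ β t c)
      threshold t c (inj₁ always) = inj₁ λ i i<n →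
        let q , p≤q , q≤ , h = smaller-nearby (size-doubling M D additive t (cmp t t) (p<M i<n)) (suc g) (p i) (0<p i) ≤-refl
            lo≤q , q≤hi = nearby i<n p≤q q≤
            β< = always q lo≤q q≤hi
        in ≤-trans (*-monoʳ-≤ K (<⇒≤ β<)) (K*≤′ h) ,
           ≤-trans (≤-trans (m^n>0 2 (suc g)) (m≤m*n _ (S t q) {{>-nonZero (≤-<-trans z≤n β<)}})) h
      threshold t c (inj₂ never) = inj₂ λ i i<n →
        let q , p≤q , q≤ , h = larger-nearby (size-doubling M D additive t (cmp t t) (p<M i<n)) (suc g) (p i) (0<p i) ≤-refl
            lo≤q , q≤hi = nearby i<n p≤q q≤
        in ≤-trans (K*≤′ h) (≮⇒≥ (never q lo≤q q≤hi))

  Separated : (ℕ → ℕ) → Set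
  Separated at =
    (∀ i j → i < j → at i < at j) × (∀ i → 0 < at i) × (∀ i → i < n → at i < M) ×
    (∀ t t′ → (∀ i j → i < j → j < n → K * S t (at i) ≤ S t′ (at j)) ⊎
              (∀ i j → i < j → j < n → K * S t′ (at j) ≤ S t (at i))) ×
    (∀ t c → (∀ i → i < n → K * β t c ≤ S t (at i) × 0 < S t (at i)) ⊎ (∀ i → i < n → K * S t (at i) ≤ β t c))

  separatedPositions : ∃[ at ] Separated at
  separatedPositions = conclude (constantInterval (k * h) w M (Exceeds ∘ remQuot h) exceeds? monotone 1 1+≤M)
    where
    exceeds? : ∀ c i → Dec (Exceeds (remQuot h c) i)
    exceeds? c i = β (proj₁ (remQuot h c)) (proj₂ (remQuot {k} h c)) <? S (proj₁ (remQuot h c)) i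

    monotone : ∀ c → IncreasingOrDecreasing (Exceeds (remQuot h c)) M
    monotone c = let t = proj₁ (remQuot {k} h c) in
      size-monotone M D additive t (cmp t t) (β t (proj₂ (remQuot {k} h c)))

    1+≤M : 1 + 2 ^ (k * h) * w ≤ M
    1+≤M = n≤1+n (1 + 2 ^ (k * h) * w)

    conclude : ∃[ lo ] (1 ≤ lo × lo + w ≤ 1 + 2 ^ (k * h) * w ×
      (∀ c → AlwaysOrNever (Exceeds (remQuot h c)) lo (lo + w))) → ∃[ at ] Separated at
    conclude (lo , 0<lo , hi , always) =
      at lo 0<lo lo+w<M ,
      (λ i j i<j → <-trans (s≤s (m≤m+n (p lo 0<lo lo+w<M i + suc g) (suc g))) (at-step lo 0<lo lo+w<M i<j)) ,
      (λ i → ≤-trans (0<p lo 0<lo lo+w<M i) (m≤m+n (p lo 0<lo lo+w<M i) (suc g))) ,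
      (λ i i<n → ≤-<-trans (m≤m+n (p lo 0<lo lo+w<M i + suc g) (suc g)) (p<M lo 0<lo lo+w<M i<n)) ,
      gap lo 0<lo lo+w<M ,
      λ t c → threshold lo 0<lo lo+w<M t c
        (subst (λ tc → AlwaysOrNever (Exceeds tc) lo (lo + w)) (Fin.remQuot-combine t c) (always (combine t c)))
      where
      lo+w<M : lo + w < M
      lo+w<M = s≤s hi

n<2^n : ∀ n → n < 2 ^ n
n<2^n zero    = s≤s z≤n
n<2^n (suc n) = +-mono-≤ (m^n>0 2 n) (≤-trans (n<2^n n) (m≤m+n (2 ^ n) 0))

-- Sums of integer sequences at increasing tuples of indices

module _ (m r h n N : ℕ) (x : Fin m → Fin (suc r) → Fin N → ℤ) (θ : Fin m → Fin h → ℤ) where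

  private
    k M : ℕ
    k = m * suc r
    M = room (k * h) n (suc r)

    xᵏ : Fin k → Fin N → ℤ
    xᵏ t = uncurry x (remQuot (suc r) t)

    xᵏ-combine : ∀ l a → xᵏ (combine l a) ≡ x l a
    xᵏ-combine l a = cong (uncurry x) (Fin.remQuot-combine l a)

  AllSumsDecided : (Fin n → Fin N) → Set
  AllSumsDecided z = ∀ l c →
    (∀ (i : Fin (suc r) → Fin n) → StrictlyIncreasing i → θ l c ℤ.< sum (λ a → x l a (z (i a)))) ⊎
    (∀ (i : Fin (suc r) → Fin n) → StrictlyIncreasing i → ¬ θ l c ℤ.< sum (λ a → x l a (z (i a))))

  private
    module _ (f : ℕ → Fin N) (f< : ∀ i j → i < j → j ≤ M → f i Fin.< f j)
      (mono : ∀ t → Monotone (xᵏ t ∘ f) M)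
      (cmp : ∀ t t′ → Comparable M (gaps (xᵏ t ∘ f)) (gaps (xᵏ t′ ∘ f)))
      where

      base′ : Fin k → ℤ
      base′ t = base (xᵏ t ∘ f) M (cmp t t)

      -- Summands are measured from their base values, so the threshold is shifted by the sum of
      -- these.
      B : Fin m → Fin h → ℤ
      B l c = θ l c ℤ.- sum (λ a → base′ (combine l a))

      β : Fin k → Fin h → ℕ
      β t c = ∣ B (proj₁ (remQuot {m} (suc r) t)) c ∣

      S : Fin k → ℕ → ℕ
      S t = size M (gaps (xᵏ t ∘ f)) (cmp t t)

      module _ (at : ℕ → ℕ) (at< : ∀ i j → i < j → at i < at j) (0<at : ∀ i → 0 < at i)
        (at<M : ∀ i → i < n → at i < M)
        (gap : ∀ t t′ → (∀ i j → i < j → j < n → suc (suc r) * S t (at i) ≤ S t′ (at j)) ⊎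
                        (∀ i j → i < j → j < n → suc (suc r) * S t′ (at j) ≤ S t (at i)))
        (threshold : ∀ t c → (∀ i → i < n → suc (suc r) * β t c ≤ S t (at i) × 0 < S t (at i)) ⊎
                             (∀ i → i < n → suc (suc r) * S t (at i) ≤ β t c))
        where

        z : Fin n → Fin N
        z v = f (at (toℕ v))

        z< : StrictlyIncreasing z
        z< {a} {b} a<b = f< (at (toℕ a)) (at (toℕ b)) (at< (toℕ a) (toℕ b) a<b) (<⇒≤ (at<M (toℕ b) (Fin.toℕ<n b)))

        I : Set
        I = ∃[ i ] StrictlyIncreasing {suc r} {n} i

        module _ (l : Fin m) (c : Fin h) where

          w : I → Fin (suc r) → ℤ
          w (i , _) a = xᵏ (combine l a) (z (i a)) ℤ.- base′ (combine l a)

          ∣w∣ : ∀ i a → S (combine l a) (at (toℕ (proj₁ i a))) ≡ ∣ w i a ∣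
          ∣w∣ (i , _) a = sym (∣y-base∣≡size (xᵏ (combine l a) ∘ f) M (cmp (combine l a) (combine l a)) (at (toℕ (i a))))

          -- As `i` is increasing, `a < b` fixes the order of the two positions, and `gap` then
          -- decides between the summands independently of `i`.
          pairs : ∀ a b → a Fin.< b → (∀ i → suc (suc r) * ∣ w i a ∣ ≤ ∣ w i b ∣) ⊎
                                      (∀ i → suc (suc r) * ∣ w i b ∣ ≤ ∣ w i a ∣)
          pairs a b a<b = Sum.map
            (λ f i → subst₂ (λ u v → suc (suc r) * u ≤ v) (∣w∣ i a) (∣w∣ i b)
              (f (toℕ (proj₁ i a)) (toℕ (proj₁ i b)) (proj₂ i a<b) (Fin.toℕ<n (proj₁ i b))))
            (λ f i → subst₂ (λ u v → suc (suc r) * u ≤ v) (∣w∣ i b) (∣w∣ i a)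
              (f (toℕ (proj₁ i a)) (toℕ (proj₁ i b)) (proj₂ i a<b) (Fin.toℕ<n (proj₁ i b))))
            (gap (combine l a) (combine l b))

          β≡ : ∀ a → β (combine l a) c ≡ ∣ B l c ∣
          β≡ a = cong (λ la → ∣ B (proj₁ la) c ∣) (Fin.remQuot-combine l a)

          bound : ∀ a → (∀ i → suc (suc r) * ∣ B l c ∣ ≤ ∣ w i a ∣ × 0 < ∣ w i a ∣) ⊎
                        (∀ i → suc (suc r) * ∣ w i a ∣ ≤ ∣ B l c ∣)
          bound a = Sum.map
            (λ f i → subst₂ (λ b u → suc (suc r) * b ≤ u × 0 < u) (β≡ a) (∣w∣ i a)
              (f (toℕ (proj₁ i a)) (Fin.toℕ<n (proj₁ i a))))
            (λ f i → subst₂ (λ b u → suc (suc r) * u ≤ b) (β≡ a) (∣w∣ i a)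
              (f (toℕ (proj₁ i a)) (Fin.toℕ<n (proj₁ i a))))
            (threshold (combine l a) c)

          signs : ∀ a → (∀ i → 0ℤ ℤ.≤ w i a) ⊎ (∀ i → w i a ℤ.≤ 0ℤ)
          signs a = Sum.map
            (λ f i → f (at (toℕ (proj₁ i a))) (0<at _) (at<M _ (Fin.toℕ<n (proj₁ i a))))
            (λ f i → f (at (toℕ (proj₁ i a))) (0<at _) (at<M _ (Fin.toℕ<n (proj₁ i a))))
            (y-base-sign (xᵏ (combine l a) ∘ f) M (mono (combine l a)) (cmp (combine l a) (combine l a)))

          Σbase : ℤ
          Σbase = sum (λ a → base′ (combine l a))

          cancel : ∀ i b → i ℤ.- b ℤ.+ b ≡ i
          cancel = ℤ-Solver.solve-∀

          cancel′ : ∀ i b → i ℤ.+ b ℤ.- b ≡ i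
          cancel′ = ℤ-Solver.solve-∀

          Σw+Σbase : ∀ i → sum (w i) ℤ.+ Σbase ≡ sum (λ a → x l a (z (proj₁ i a)))
          Σw+Σbase i = trans (sym (∑-distrib-+ (w i) (λ a → base′ (combine l a))))
            (sum-cong-≗ λ a → trans (cancel (xᵏ (combine l a) (z (proj₁ i a))) (base′ (combine l a)))
                                    (cong (λ g → g (z (proj₁ i a))) (xᵏ-combine l a)))

          B<⇒θ< : ∀ i → B l c ℤ.< sum (w i) → θ l c ℤ.< sum (λ a → x l a (z (proj₁ i a)))
          B<⇒θ< i h = subst₂ ℤ._<_ (cancel (θ l c) Σbase) (Σw+Σbase i) (ℤ.+-monoˡ-< Σbase h)

          θ<⇒B< : ∀ i → θ l c ℤ.< sum (λ a → x l a (z (proj₁ i a))) → B l c ℤ.< sum (w i)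
          θ<⇒B< i h = subst (B l c ℤ.<_)
            (trans (cong (ℤ._- Σbase) (sym (Σw+Σbase i))) (cancel′ (sum (w i)) Σbase))
            (ℤ.+-monoˡ-< (ℤ.- Σbase) h)

        decided : AllSumsDecided z
        decided l c = Sum.map
          (λ f i i< → B<⇒θ< l c (i , i<) (f (i , i<)))
          (λ f i i< θ< → f (i , i<) (θ<⇒B< l c (i , i<) θ<))
          (dominated⇒constant (w l c) (B l c) (pairs l c) (bound l c) (signs l c))

      semilinear : ∃[ z ] (StrictlyIncreasing z × AllSumsDecided z)
      semilinear = let at , at< , 0<at , at<M , gap , threshold =
                         -- The domination factor `suc (suc r)` is at most `2 ^ suc r`, so windows
                         -- of radius `suc (suc r)` suffice.
                         separatedPositions n (suc r) (suc (suc r)) (n<2^n (suc r)) (λ t → gaps (xᵏ t ∘ f))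
                           (λ t → gaps-additive (mono t)) cmp β
                   in z at at< 0<at at<M gap threshold , (λ {a} {b} → z< at at< 0<at at<M gap threshold {a} {b}) ,
                      decided at at< 0<at at<M gap threshold

  semilinearRamsey :
    treeSize (m * suc r) (room (m * suc r * h) n (suc r) ^ suc (m * suc r * (m * suc r))) ≤ N →
    ∃[ z ] (StrictlyIncreasing z × AllSumsDecided z)
  semilinearRamsey h = let f , f< , mono , cmp = lacunarySubsequence k N xᵏ M h in semilinear f f< mono cmp

-- Classifying signs up to double negation

infixl 1 _>>=_
_>>=_ : {A B : Set} → ¬ ¬ A → (A → ¬ ¬ B) → ¬ ¬ B
(a >>= f) ¬b = a λ x → f x ¬b

return : {A : Set} → A → ¬ ¬ A
return a ¬a = ¬a a

Enumerable : Set → Set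
Enumerable J = ∃[ xs ] (∀ (j : J) → j ∈ xs)

enum-Fin : ∀ {n} → Enumerable (Fin n)
enum-Fin = List.allFin _ , List.∈-allFin

enum-× : ∀ {A B} → Enumerable A → Enumerable B → Enumerable (A × B)
enum-× (xs , ∈xs) (ys , ∈ys) =
  List.cartesianProduct xs ys , λ (a , b) → List.∈-cartesianProduct⁺ (∈xs a) (∈ys b)

enum-Vec : ∀ {A} → Enumerable A → ∀ n → Enumerable (Vec A n)
enum-Vec en zero = [] ∷ [] , λ { [] → here refl }
enum-Vec en@(xs , ∈xs) (suc n) with ys , ∈ys ← enum-Vec en n =
  List.cartesianProductWith Vec._∷_ xs ys , λ { (x ∷ v) → List.∈-cartesianProductWith⁺ Vec._∷_ (∈xs x) (∈ys v) }

enum-Sign : Enumerable Sign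
enum-Sign = pos ∷ neg ∷ nul ∷ [] , λ where
  pos → here refl
  neg → there (here refl)
  nul → there (there (here refl))

-- A finite conjunction commutes with double negation. The operation `_∨_` merges two witnesses into
-- one that serves both: the smaller margin, the later index, the product of denominators.
¬¬-common : {J B : Set} → Enumerable J → (Q : J → B → Set) (_∨_ : B → B → B) → B →
  (∀ {j b c} → Q j b → Q j (b ∨ c)) → (∀ {j b c} → Q j c → Q j (b ∨ c)) →
  (∀ j → ¬ ¬ (∃[ b ] Q j b)) → ¬ ¬ (∃[ b ] (∀ j → Q j b))
¬¬-common {J} {B} (xs , ∈xs) Q _∨_ b₀ left right each =
  common xs >>= λ (b , all) → return (b , λ j → All.lookup all (∈xs j))
  where
  common : (ys : List J) → ¬ ¬ (∃[ b ] All (λ j → Q j b) ys)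
  common []       = return (b₀ , [])
  common (y ∷ ys) = each y >>= λ (b , q) → common ys >>= λ (c , qs) → return (b ∨ c , left q ∷ All.map right qs)

-- A decidable substitute for the sign of a real of which only an approximation `q` is at hand: what
-- lies within `ε` of zero counts as zero.
classify : ℚ → ℚ → Sign
classify ε q with ε ℚ.<? q | q ℚ.<? ℚ.- ε
... | yes _ | _     = pos
... | no  _ | yes _ = neg
... | no  _ | no  _ = nul

classify-pos : ∀ {ε q} → ε ℚ.< q → classify ε q ≡ pos
classify-pos {ε} {q} h with ε ℚ.<? q
... | yes _ = refl
... | no ¬h = contradiction h ¬h

private
  -<+ : ∀ {ε} → 0ℚ ℚ.< ε → ℚ.- ε ℚ.< ε
  -<+ 0<ε = ℚ.<-trans (ℚ.neg-antimono-< 0<ε) 0<ε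

classify-neg : ∀ {ε q} → 0ℚ ℚ.< ε → q ℚ.< ℚ.- ε → classify ε q ≡ neg
classify-neg {ε} {q} 0<ε h with ε ℚ.<? q | q ℚ.<? ℚ.- ε
... | yes ε<q | _     = contradiction (ℚ.<-trans (ℚ.<-trans ε<q h) (-<+ 0<ε)) (ℚ.<-irrefl refl)
... | no _    | yes _ = refl
... | no _    | no ¬h = contradiction h ¬h

private
  neg-neg : ∀ p → ℚ.- (ℚ.- p) ≡ p
  neg-neg = solve 1 (λ p → :- (:- p) := p) refl
    where open +-*-Solver

p≤∣p∣ : ∀ p → p ℚ.≤ ℚ.∣ p ∣
p≤∣p∣ p with ℚ.≤-total 0ℚ p
... | inj₁ 0≤p = ℚ.≤-reflexive (sym (ℚ.0≤p⇒∣p∣≡p 0≤p))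
... | inj₂ p≤0 = ℚ.≤-trans p≤0 (ℚ.0≤∣p∣ p)

-p≤∣p∣ : ∀ p → ℚ.- p ℚ.≤ ℚ.∣ p ∣
-p≤∣p∣ p = subst (ℚ.- p ℚ.≤_) (ℚ.∣-p∣≡∣p∣ p) (p≤∣p∣ (ℚ.- p))

∣p∣≤ε⇒p≮-ε : ∀ {p ε} → ℚ.∣ p ∣ ℚ.≤ ε → ¬ p ℚ.< ℚ.- ε
∣p∣≤ε⇒p≮-ε {p} {ε} h p<-ε = ℚ.<-irrefl refl (ℚ.<-≤-trans
  (subst (ℚ._< ℚ.- p) (neg-neg ε) (ℚ.neg-antimono-< p<-ε)) (ℚ.≤-trans (-p≤∣p∣ p) h))

∣p∣≤ : ∀ {p ε} → ¬ ε ℚ.< p → ¬ p ℚ.< ℚ.- ε → ℚ.∣ p ∣ ℚ.≤ ε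
∣p∣≤ {p} {ε} ε≮p p≮-ε with ℚ.∣p∣≡p∨∣p∣≡-p p
... | inj₁ eq = subst (ℚ._≤ ε) (sym eq) (ℚ.≮⇒≥ ε≮p)
... | inj₂ eq = subst₂ ℚ._≤_ (sym eq) (neg-neg ε) (ℚ.neg-antimono-≤ (ℚ.≮⇒≥ p≮-ε))

classify-nul : ∀ {ε q} → ℚ.∣ q ∣ ℚ.≤ ε → classify ε q ≡ nul
classify-nul {ε} {q} h with ε ℚ.<? q | q ℚ.<? ℚ.- ε
... | yes ε<q | _      = contradiction (ℚ.<-≤-trans ε<q (ℚ.≤-trans (p≤∣p∣ q) h)) (ℚ.<-irrefl refl)
... | no _    | yes q< = contradiction q< (∣p∣≤ε⇒p≮-ε h)
... | no _    | no _   = refl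

half : ∀ {ε} → 0ℚ ℚ.< ε → 0ℚ ℚ.< ½ ℚ.* ε × ½ ℚ.* ε ℚ.+ ½ ℚ.* ε ≡ ε × ½ ℚ.* ε ℚ.< ε
half {ε} 0<ε = 0<δ , double , subst₂ ℚ._<_ (ℚ.+-identityˡ δ) double (ℚ.+-monoˡ-< δ 0<δ)
  where
  δ : ℚ
  δ = ½ ℚ.* ε

  0<δ : 0ℚ ℚ.< δ
  0<δ = ℚ.positive⁻¹ δ {{ℚ.pos*pos⇒pos ½ ε {{ℚ.positive 0<ε}}}}

  double : δ ℚ.+ δ ≡ ε
  double = trans (sym (ℚ.*-distribʳ-+ ε ½ ½)) (ℚ.*-identityˡ ε)

private
  a≡[a-b]+b : ∀ a b → a ≡ (a ℚ.- b) ℚ.+ b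
  a≡[a-b]+b = solve 2 (λ a b → a := (a :- b) :+ b) refl
    where open +-*-Solver

  collect-δ : ∀ a δ → (δ ℚ.+ a) ℚ.+ δ ≡ a ℚ.+ (δ ℚ.+ δ)
  collect-δ = solve 2 (λ a δ → (δ :+ a) :+ δ := a :+ (δ :+ δ)) refl
    where open +-*-Solver

-- A term of absolute value above ε beyond a modulus for ½ ε fixes the sign.
sign-exists : ∀ x → ¬ ¬ (∃[ s ] HasSign x s)
sign-exists x none = none (nul , zero′)
  where
  zero′ : x ≃ᴿ 0ᴿ
  zero′ ε 0<ε = k , λ i k≤i → subst (λ q → ℚ.∣ q ∣ ℚ.≤ ε) (sym (ℚ.+-identityʳ (seq x i)))
      (∣p∣≤ (ε≮ i k≤i) (≮-ε i k≤i))
    where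
    open ℚ.≤-Reasoning

    δ : ℚ
    δ = ½ ℚ.* ε

    0<δ = proj₁ (half 0<ε)
    k   = proj₁ (cauchy x δ 0<δ)

    near : ∀ i j → k ≤ i → k ≤ j → seq x i ℚ.- seq x j ℚ.≤ δ
    near i j k≤i k≤j = ℚ.≤-trans (p≤∣p∣ _) (proj₂ (cauchy x δ 0<δ) i j k≤i k≤j)

    ε≮ : ∀ i → k ≤ i → ¬ ε ℚ.< seq x i
    ε≮ i k≤i ε<x = none (pos , δ , 0<δ , k , λ j k≤j → ℚ.≮⇒≥ λ xj<δ → ℚ.<-irrefl refl (begin-strict
      seq x i                                  ≡⟨ a≡[a-b]+b (seq x i) (seq x j) ⟩
      (seq x i ℚ.- seq x j) ℚ.+ seq x j        ≤⟨ ℚ.+-monoˡ-≤ (seq x j) (near i j k≤i k≤j) ⟩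
      δ ℚ.+ seq x j                            <⟨ ℚ.+-monoʳ-< δ xj<δ ⟩
      δ ℚ.+ (0ℚ ℚ.+ δ)                         ≡⟨ cong (δ ℚ.+_) (ℚ.+-identityˡ δ) ⟩
      δ ℚ.+ δ                                  ≡⟨ proj₁ (proj₂ (half 0<ε)) ⟩
      ε                                        <⟨ ε<x ⟩
      seq x i                                  ∎))

    ≮-ε : ∀ i → k ≤ i → ¬ seq x i ℚ.< ℚ.- ε
    ≮-ε i k≤i x<-ε = none (neg , δ , 0<δ , k , λ j k≤j → begin
      seq x j ℚ.+ δ                                  ≡⟨ cong (ℚ._+ δ) (a≡[a-b]+b (seq x j) (seq x i)) ⟩
      ((seq x j ℚ.- seq x i) ℚ.+ seq x i) ℚ.+ δ      ≤⟨ ℚ.+-monoˡ-≤ δ (ℚ.+-monoˡ-≤ (seq x i) (near j i k≤j k≤i)) ⟩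
      (δ ℚ.+ seq x i) ℚ.+ δ                          ≡⟨ collect-δ (seq x i) δ ⟩
      seq x i ℚ.+ (δ ℚ.+ δ)                          ≡⟨ cong (seq x i ℚ.+_) (proj₁ (proj₂ (half 0<ε))) ⟩
      seq x i ℚ.+ ε                                  ≤⟨ ℚ.+-monoˡ-≤ ε (ℚ.<⇒≤ x<-ε) ⟩
      ℚ.- ε ℚ.+ ε                                    ≡⟨ ℚ.+-inverseˡ ε ⟩
      0ℚ                                             ∎)

-- A zero imposes no condition, because its terms eventually fall below any positive `ε`. Hence
-- margins only improve as `ε` decreases, and finitely many reals share one.
Margin : ℝ → Sign → ℚ → Set
Margin x pos ε = ∃[ k ] (∀ i → k ≤ i → ε ℚ.< seq x i)
Margin x neg ε = ∃[ k ] (∀ i → k ≤ i → seq x i ℚ.< ℚ.- ε)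
Margin x nul ε = ⊤

margin-mono : ∀ x s {ε ε′} → ε′ ℚ.≤ ε → Margin x s ε → Margin x s ε′
margin-mono x pos ε′≤ε (k , h) = k , λ i k≤i → ℚ.≤-<-trans ε′≤ε (h i k≤i)
margin-mono x neg ε′≤ε (k , h) = k , λ i k≤i → ℚ.<-≤-trans (h i k≤i) (ℚ.neg-antimono-≤ ε′≤ε)
margin-mono x nul ε′≤ε h       = tt

sign⇒margin : ∀ x s → HasSign x s → ∃[ ε ] (0ℚ ℚ.< ε × Margin x s ε)
sign⇒margin x pos (ε , 0<ε , k , h) = ½ ℚ.* ε , proj₁ (half 0<ε) , k , λ i k≤i →
  ℚ.<-≤-trans (proj₂ (proj₂ (half 0<ε))) (ℚ.≤-trans (ℚ.≤-reflexive (sym (ℚ.+-identityˡ ε))) (h i k≤i))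
sign⇒margin x neg (ε , 0<ε , k , h) = ½ ℚ.* ε , proj₁ (half 0<ε) , k , λ i k≤i → begin-strict
  seq x i                      ≡⟨ add-sub (seq x i) ε ⟩
  (seq x i ℚ.+ ε) ℚ.- ε        ≤⟨ ℚ.+-monoˡ-≤ (ℚ.- ε) (h i k≤i) ⟩
  0ℚ ℚ.- ε                     ≡⟨ ℚ.+-identityˡ (ℚ.- ε) ⟩
  ℚ.- ε                        <⟨ ℚ.neg-antimono-< (proj₂ (proj₂ (half 0<ε))) ⟩
  ℚ.- (½ ℚ.* ε)                ∎
  where
  open ℚ.≤-Reasoning
  add-sub : ∀ a b → a ≡ (a ℚ.+ b) ℚ.- b
  add-sub = solve 2 (λ a b → a := (a :+ b) :- b) refl
    where open +-*-Solver
sign⇒margin x nul _ = 1ℚ , ℚ.positive⁻¹ 1ℚ , tt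

eventually-classified : ∀ x s {ε} → 0ℚ ℚ.< ε → Margin x s ε → HasSign x s →
  ∃[ k ] (∀ i → k ≤ i → classify ε (seq x i) ≡ s)
eventually-classified x pos 0<ε (k , h) _ = k , λ i k≤i → classify-pos (h i k≤i)
eventually-classified x neg 0<ε (k , h) _ = k , λ i k≤i → classify-neg 0<ε (h i k≤i)
eventually-classified x nul {ε} 0<ε _ x≃0 with k , h ← x≃0 ε 0<ε =
  k , λ i k≤i → classify-nul (subst (λ q → ℚ.∣ q ∣ ℚ.≤ ε) (ℚ.+-identityʳ (seq x i)) (h i k≤i))

-- Two rounds are needed because the index depends on the threshold: the smaller `ε` is, the later
-- the terms of a zero get below it.
¬¬-approximation : {J : Set} → Enumerable J → (x : J → ℝ) →
  ¬ ¬ (∃[ ε ] ∃[ k ] (0ℚ ℚ.< ε × (∀ j s → HasSign (x j) s → classify ε (seq (x j) k) ≡ s)))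
¬¬-approximation {J} enum x =
  ¬¬-common (enum-× enum enum-Sign) (λ (j , s) (ε , _) → HasSign (x j) s → Margin (x j) s ε) _⊓⁺_ (1ℚ , ℚ.positive⁻¹ 1ℚ)
    (λ {(j , s)} {(ε , _)} {(ε′ , _)} q hs → margin-mono (x j) s (ℚ.p⊓q≤p ε ε′) (q hs))
    (λ {(j , s)} {(ε , _)} {(ε′ , _)} q hs → margin-mono (x j) s (ℚ.p⊓q≤q ε ε′) (q hs))
    margin >>= λ ((ε , 0<ε) , margins) →
  ¬¬-common (enum-× enum enum-Sign)
    (λ (j , s) k → HasSign (x j) s → ∀ i → k ≤ i → classify ε (seq (x j) i) ≡ s) _⊔_ 0
    (λ q hs i k≤i → q hs i (≤-trans (m≤m⊔n _ _) k≤i))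
    (λ q hs i k≤i → q hs i (≤-trans (m≤n⊔m _ _) k≤i))
    (index 0<ε margins) >>= λ (k , classified) →
  return (ε , k , 0<ε , λ j s hs → classified (j , s) hs k ≤-refl)
  where
  _⊓⁺_ : ∃[ ε ] (0ℚ ℚ.< ε) → ∃[ ε ] (0ℚ ℚ.< ε) → ∃[ ε ] (0ℚ ℚ.< ε)
  (ε , 0<ε) ⊓⁺ (ε′ , 0<ε′) = ε ℚ.⊓ ε′ , ⊓-pos
    where
    ⊓-pos : 0ℚ ℚ.< ε ℚ.⊓ ε′
    ⊓-pos with ℚ.⊓-sel ε ε′
    ... | inj₁ eq = subst (0ℚ ℚ.<_) (sym eq) 0<ε
    ... | inj₂ eq = subst (0ℚ ℚ.<_) (sym eq) 0<ε′

  margin : ∀ js → ¬ ¬ (∃[ ε ] (HasSign (x (proj₁ js)) (proj₂ js) → Margin (x (proj₁ js)) (proj₂ js) (proj₁ ε)))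
  margin (j , s) = ¬¬-excluded-middle >>= λ where
    (yes hs) → let ε , 0<ε , mg = sign⇒margin (x j) s hs in return ((ε , 0<ε) , λ _ → mg)
    (no ¬hs) → return ((1ℚ , ℚ.positive⁻¹ 1ℚ) , λ hs → contradiction hs ¬hs)

  index : ∀ {ε} → 0ℚ ℚ.< ε → (∀ js → HasSign (x (proj₁ js)) (proj₂ js) → Margin (x (proj₁ js)) (proj₂ js) ε) →
    ∀ js → ¬ ¬ (∃[ k ] (HasSign (x (proj₁ js)) (proj₂ js) → ∀ i → k ≤ i → classify ε (seq (x (proj₁ js)) i) ≡ proj₂ js))
  index 0<ε margins (j , s) = ¬¬-excluded-middle >>= λ where
    (yes hs) → let k , h = eventually-classified (x j) s 0<ε (margins (j , s) hs) hs in return (k , λ _ → h)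
    (no ¬hs) → return (0 , λ hs → contradiction hs ¬hs)

-- From reals to integers

enum-⊎ : ∀ {A B} → Enumerable A → Enumerable B → Enumerable (A ⊎ B)
enum-⊎ (xs , ∈xs) (ys , ∈ys) = List.map inj₁ xs ++ List.map inj₂ ys , λ where
  (inj₁ a) → List.∈-++⁺ˡ (List.∈-map⁺ inj₁ (∈xs a))
  (inj₂ b) → List.∈-++⁺ʳ (List.map inj₁ xs) (List.∈-map⁺ inj₂ (∈ys b))

unitAt : ∀ {n} → Fin n → Fin n → ℚ → ℚ
unitAt zero    zero    q = q
unitAt zero    (suc b) q = 0ℚ
unitAt (suc a) zero    q = 0ℚ
unitAt (suc a) (suc b) q = unitAt a b q

sum-unitAt : ∀ {n} (a : Fin n) (t : Fin n → ℚ) → ℚΣ.sum (λ b → unitAt a b (t b)) ≡ t a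
sum-unitAt {suc n} zero t = trans (cong (t zero ℚ.+_) (ℚΣ.sum-replicate-zero n)) (ℚ.+-identityʳ (t zero))
sum-unitAt {suc n} (suc a) t = trans (ℚ.+-identityˡ _) (sum-unitAt a (t ∘ suc))

module _ {r d : ℕ} (k : ℕ) where

  private
    coords : (Fin (suc r) → Fin d → ℝ) → Fin (suc r) → Fin d → ℚ
    coords p a b = seq (p a b) k

    value : Polynomial (Fin (suc r) × Fin d) → (Fin (suc r) → Fin d → ℝ) → ℚ
    value f p = seq (eval f (λ (a , b) → p a b)) k

    value-∷ : ∀ α w f p → value ((α , w) ∷ f) p ≡
      seq α k ℚ.* seq (evalMonomial w (λ (a , b) → p a b)) k ℚ.+ value f p
    value-∷ α w f p = refl

  -- Real sums and products are formed term by term. At a fixed index `k` the value is therefore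
  -- exact rational arithmetic on the `k`-th terms of the coordinates, and no error estimate enters.
  Separates : Polynomial (Fin (suc r) × Fin d) → (Fin (suc r) → (Fin d → ℚ) → ℚ) → Set
  Separates f g = ∀ (p : Fin (suc r) → Fin d → ℝ) →
    seq (eval f (λ (a , b) → p a b)) k ≡ ℚΣ.sum (λ a → g a (λ b → seq (p a b) k))

  private
    addTerm : ∀ α w f g a (t : (Fin d → ℚ) → ℚ) → Separates f g →
      (∀ p → seq α k ℚ.* seq (evalMonomial w (λ (a , b) → p a b)) k ≡ t (coords p a)) →
      ∃[ g ] Separates ((α , w) ∷ f) g
    addTerm α w f g a t g≡ t≡ = (λ a′ u → unitAt a a′ (t u) ℚ.+ g a′ u) , λ p → begin
      value ((α , w) ∷ f) p                                                          ≡⟨ value-∷ α w f p ⟩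
      seq α k ℚ.* seq (evalMonomial w (λ (a , b) → p a b)) k ℚ.+ value f p           ≡⟨ cong (ℚ._+ value f p) (t≡ p) ⟩
      t (coords p a) ℚ.+ value f p                                                   ≡⟨ cong (t (coords p a) ℚ.+_) (g≡ p) ⟩
      t (coords p a) ℚ.+ ℚΣ.sum (λ a → g a (coords p a))
        ≡⟨ cong (ℚ._+ ℚΣ.sum (λ a → g a (coords p a))) (sum-unitAt a (λ a → t (coords p a))) ⟨
      ℚΣ.sum (λ a′ → unitAt a a′ (t (coords p a′))) ℚ.+ ℚΣ.sum (λ a → g a (coords p a))
        ≡⟨ ℚΣ.∑-distrib-+ (λ a′ → unitAt a a′ (t (coords p a′))) (λ a → g a (coords p a)) ⟨
      ℚΣ.sum (λ a′ → unitAt a a′ (t (coords p a′)) ℚ.+ g a′ (coords p a′))           ∎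
      where open ≡-Reasoning

  -- A constant term is attributed to the first point.
  affine-separates : ∀ f → HasDegree≤ 1 f → ∃[ g ] Separates f g
  affine-separates [] _ = (λ _ _ → 0ℚ) , λ p → sym (ℚΣ.sum-replicate-zero (suc r))
  affine-separates ((α , []) ∷ f) (_ ∷ f≤1) = let g , g≡ = affine-separates f f≤1 in
    addTerm α [] f g zero (λ _ → seq α k ℚ.* 1ℚ) g≡ (λ _ → refl)
  affine-separates ((α , (a , b) ∷ []) ∷ f) (_ ∷ f≤1) = let g , g≡ = affine-separates f f≤1 in
    addTerm α ((a , b) ∷ []) f g a (λ u → seq α k ℚ.* (u b ℚ.* 1ℚ)) g≡ (λ _ → refl)
  affine-separates ((α , _ ∷ _ ∷ _) ∷ f) (s≤s () ∷ _)

ι-+ : ∀ a b → ι (a ℤ.+ b) ≡ ι a ℚ.+ ι b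
ι-+ a b = ℚ.toℚᵘ-injective (ℚᵘ.≃-sym (ℚᵘ.≃-trans (ℚ.toℚᵘ-homo-+ (ι a) (ι b))
  (*≡* (cong (ℤ._* + 1) (cong₂ ℤ._+_ (ℤ.*-identityʳ a) (ℤ.*-identityʳ b))))))

ι-* : ∀ a b → ι (a ℤ.* b) ≡ ι a ℚ.* ι b
ι-* a b = ℚ.toℚᵘ-injective (ℚᵘ.≃-sym (ℚ.toℚᵘ-homo-* (ι a) (ι b)))

ι-mono-< : ∀ {a b} → a ℤ.< b → ι a ℚ.< ι b
ι-mono-< {a} {b} a<b = ℚ.*<* (subst₂ ℤ._<_ (sym (ℤ.*-identityʳ a)) (sym (ℤ.*-identityʳ b)) a<b)

ι-cancel-< : ∀ {a b} → ι a ℚ.< ι b → a ℤ.< b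
ι-cancel-< {a} {b} (ℚ.*<* h) = subst₂ ℤ._<_ (ℤ.*-identityʳ a) (ℤ.*-identityʳ b) h

*-denominator : ∀ q → ι (ℚ.↥ q) ≡ q ℚ.* ι (ℚ.↧ q)
*-denominator q@(mkℚ n d _) = ℚ.toℚᵘ-injective (ℚᵘ.≃-sym (ℚᵘ.≃-trans (ℚ.toℚᵘ-homo-* q (ι (+ suc d)))
  (*≡* (sym (trans (cong (λ e → n ℤ.* + e) (*-identityʳ (suc d))) (sym (ℤ.*-identityʳ (n ℤ.* + suc d))))))))

Integral : ℚ → ℕ → Set
Integral q D = ∃[ z ] (ι z ≡ q ℚ.* ι (+ D))

integral-* : ∀ {q b} c → Integral q b → Integral q (b * c)
integral-* {q} {b} c (z , z≡) = z ℤ.* + c , (begin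
  ι (z ℤ.* + c)                    ≡⟨ ι-* z (+ c) ⟩
  ι z ℚ.* ι (+ c)                  ≡⟨ cong (ℚ._* ι (+ c)) z≡ ⟩
  q ℚ.* ι (+ b) ℚ.* ι (+ c)        ≡⟨ ℚ.*-assoc q (ι (+ b)) (ι (+ c)) ⟩
  q ℚ.* (ι (+ b) ℚ.* ι (+ c))      ≡⟨ cong (q ℚ.*_) (ι-* (+ b) (+ c)) ⟨
  q ℚ.* ι (+ b ℤ.* + c)            ≡⟨ cong (λ z → q ℚ.* ι z) (ℤ.pos-* b c) ⟨
  q ℚ.* ι (+ (b * c))            ∎)
  where open ≡-Reasoning

¬¬-commonDenominator : {J : Set} → Enumerable J → (q : J → ℚ) →
  ¬ ¬ (∃[ D ] (0 < D × (∀ j → Integral (q j) D)))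
¬¬-commonDenominator enum q =
  ¬¬-common enum (λ j (D , _) → Integral (q j) D) _*⁺_ (1 , s≤s z≤n)
    (λ { {j} {b , _} {c , _} → integral-* {q j} {b} c })
    (λ { {j} {b , _} {c , _} int → subst (Integral (q j)) (*-comm c b) (integral-* {q j} {c} b int) })
    (λ j → return ((ℚ.↧ₙ (q j) , s≤s z≤n) , ℚ.↥ (q j) , *-denominator (q j))) >>= λ ((D , 0<D) , int) →
  return (D , 0<D , int)
  where
  _*⁺_ : ∃[ D ] (0 < D) → ∃[ D ] (0 < D) → ∃[ D ] (0 < D)
  (b , 0<b) *⁺ (c , 0<c) = b * c , *-mono-≤ 0<b 0<c

ι-sum : ∀ {n} (x : Fin n → ℤ) (q : Fin n → ℚ) s → (∀ a → ι (x a) ≡ q a ℚ.* s) → ι (sum x) ≡ ℚΣ.sum q ℚ.* s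
ι-sum {zero}  x q s h = sym (ℚ.*-zeroˡ s)
ι-sum {suc n} x q s h = trans (ι-+ (x zero) (sum (x ∘ suc)))
  (trans (cong₂ ℚ._+_ (h zero) (ι-sum (x ∘ suc) (q ∘ suc) s (h ∘ suc))) (sym (ℚ.*-distribʳ-+ s (q zero) _)))

classify-cong : ∀ {ε q q′} → (ε ℚ.< q → ε ℚ.< q′) → (ε ℚ.< q′ → ε ℚ.< q) →
  (q ℚ.< ℚ.- ε → q′ ℚ.< ℚ.- ε) → (q′ ℚ.< ℚ.- ε → q ℚ.< ℚ.- ε) → classify ε q ≡ classify ε q′
classify-cong {ε} {q} {q′} f g f′ g′ with ε ℚ.<? q | ε ℚ.<? q′ | q ℚ.<? ℚ.- ε | q′ ℚ.<? ℚ.- ε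
... | yes _ | yes _ | _     | _     = refl
... | yes p | no ¬p | _     | _     = contradiction (f p) ¬p
... | no ¬p | yes p | _     | _     = contradiction (g p) ¬p
... | no _  | no _  | yes _ | yes _ = refl
... | no _  | no _  | yes p | no ¬p = contradiction (f′ p) ¬p
... | no _  | no _  | no ¬p | yes p = contradiction (g′ p) ¬p
... | no _  | no _  | no _  | no _  = refl

-- place i stands for point ∘ i.  It is a variable because comparing two
-- expressions for it under eval would make Agda unfold real arithmetic.
module _ {m r d N : ℕ} (f : Fin m → Polynomial (Fin (suc r) × Fin d)) (f≤1 : ∀ l → HasDegree≤ 1 (f l))
  (point : Fin N → Fin d → ℝ) (place : (Fin (suc r) → Fin N) → Fin (suc r) → Fin d → ℝ)
  (place≡ : ∀ i a → place i a ≡ point (i a)) where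

  private
    -- Tuples are vectors because functions on `Fin` cannot be enumerated up to propositional
    -- equality without extensionality.
    Tuple : Set
    Tuple = Vec (Fin N) (suc r)

    e : Fin m × Tuple → ℝ
    e (l , v) = eval (f l) (λ (a , b) → place (lookup v) a b)

    enum-J : Enumerable (Fin m × Tuple)
    enum-J = enum-× enum-Fin (enum-Vec enum-Fin (suc r))

  SameSums : (Fin m → Fin (suc r) → Fin N → ℤ) → (Fin m → Fin 2 → ℤ) → Tuple → Tuple → Set
  SameSums x θ v v′ = ∀ l c →
    (θ l c ℤ.< sum (λ a → x l a (lookup v a)) → θ l c ℤ.< sum (λ a → x l a (lookup v′ a))) ×
    (θ l c ℤ.< sum (λ a → x l a (lookup v′ a)) → θ l c ℤ.< sum (λ a → x l a (lookup v a)))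

  private
    module _ (ε : ℚ) (k : ℕ) (approx : ∀ j s → HasSign (e j) s → classify ε (seq (e j) k) ≡ s)
      (signed : ∀ j → ∃[ s ] HasSign (e j) s) where

      g : Fin m → Fin (suc r) → (Fin d → ℚ) → ℚ
      g l = proj₁ (affine-separates k (f l) (f≤1 l))

      q : Fin m → Fin (suc r) → Fin N → ℚ
      q l a i = g l a (λ b → seq (point i b) k)

      Q : Fin m → Tuple → ℚ
      Q l v = ℚΣ.sum (λ a → q l a (lookup v a))

      seq≡Q : ∀ l v → seq (e (l , v)) k ≡ Q l v
      seq≡Q l v = trans (proj₂ (affine-separates k (f l) (f≤1 l)) (place (lookup v)))
        (ℚΣ.sum-cong-≗ λ a → cong (λ pt → g l a (λ b → seq (pt b) k)) (place≡ (lookup v) a))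

      scaled : (Fin m × Fin (suc r) × Fin N) ⊎ Fin 2 → ℚ
      scaled (inj₁ (l , a , i))  = q l a i
      scaled (inj₂ zero)         = ε
      scaled (inj₂ (suc zero))   = ℚ.- ε

      module _ (D : ℕ) (0<D : 0 < D) (x-int : ∀ l a i → Integral (q l a i) D)
        (ε-int : Integral ε D) (-ε-int : Integral (ℚ.- ε) D) where

        s : ℚ
        s = ι (+ D)

        instance
          s>0 : ℚ.Positive s
          s>0 = ℚ.positive (ι-mono-< (ℤ.+<+ 0<D))

          s≥0 : ℚ.NonNegative s
          s≥0 = ℚ.pos⇒nonNeg s

        x : Fin m → Fin (suc r) → Fin N → ℤ
        x l a i = proj₁ (x-int l a i)

        θ : Fin m → Fin 2 → ℤ
        θ l zero       = proj₁ ε-int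
        -- For integers `-E ≤ X` means `-E - 1 < X`. The test for lying below `-ε` thus becomes the
        -- negation of a strict lower bound, of the same kind as the test for lying above `ε`.
        θ l (suc zero) = ℤ.pred (proj₁ -ε-int)

        X : Fin m → Tuple → ℤ
        X l v = sum (λ a → x l a (lookup v a))

        ιX : ∀ l v → ι (X l v) ≡ Q l v ℚ.* s
        ιX l v = ι-sum (λ a → x l a (lookup v a)) (λ a → q l a (lookup v a)) s (λ a → proj₂ (x-int l a (lookup v a)))

        scale : ∀ {z z′ p p′} → ι z ≡ p ℚ.* s → ι z′ ≡ p′ ℚ.* s → p ℚ.< p′ → z ℤ.< z′
        scale z≡ z′≡ h = ι-cancel-< (subst₂ ℚ._<_ (sym z≡) (sym z′≡) (ℚ.*-monoˡ-<-pos s h))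

        unscale : ∀ {z z′ p p′} → ι z ≡ p ℚ.* s → ι z′ ≡ p′ ℚ.* s → z ℤ.< z′ → p ℚ.< p′
        unscale z≡ z′≡ h = ℚ.*-cancelʳ-<-nonNeg s (subst₂ ℚ._<_ z≡ z′≡ (ι-mono-< h))

        above : ∀ {v v′} l → SameSums x θ v v′ → ε ℚ.< Q l v → ε ℚ.< Q l v′
        above {v} {v′} l same h =
          unscale (proj₂ ε-int) (ιX l v′) (proj₁ (same l zero) (scale (proj₂ ε-int) (ιX l v) h))

        below : ∀ {v v′} l → SameSums x θ v v′ → Q l v ℚ.< ℚ.- ε → Q l v′ ℚ.< ℚ.- ε
        below {v} {v′} l same h =
          unscale (ιX l v′) (proj₂ -ε-int) (ℤ.≰⇒> λ -E≤X → ℤ.<⇒≱ (scale (ιX l v) (proj₂ -ε-int) h)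
            (pred<⇒≤ (proj₂ (same l (suc zero)) (≤⇒pred< -E≤X))))
          where
          ≤⇒pred< : ∀ {i j} → i ℤ.≤ j → ℤ.pred i ℤ.< j
          ≤⇒pred< {i} i≤j = ℤ.<-≤-trans (ℤ.i≤pred[j]⇒i<j ℤ.≤-refl) i≤j

          pred<⇒≤ : ∀ {i j} → ℤ.pred i ℤ.< j → i ℤ.≤ j
          pred<⇒≤ {i} {j} h = subst (ℤ._≤ j) (ℤ.suc-pred i) (ℤ.i<j⇒suc[i]≤j h)

        flip : ∀ v v′ → SameSums x θ v v′ → SameSums x θ v′ v
        flip v v′ same l c = proj₂ (same l c) , proj₁ (same l c)

        -- The second tuple has some signs by `signed`. Through `approx` they are given by the
        -- classification of its sums, which agrees with that of the first tuple.
        transferSigns : ∀ v v′ → SameSums x θ v v′ → ∀ σ →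
          HasSigns f (place (lookup v)) σ → HasSigns f (place (lookup v′)) σ
        transferSigns v v′ same σ hs l = let s′ , hs′ = signed (l , v′) in
          subst (HasSign (e (l , v′))) (same-sign s′ hs′) hs′
          where
          open ≡-Reasoning

          same-sign : ∀ s′ → HasSign (e (l , v′)) s′ → s′ ≡ lookup σ l
          same-sign s′ hs′ = begin
            s′                                  ≡⟨ approx (l , v′) s′ hs′ ⟨
            classify ε (seq (e (l , v′)) k)     ≡⟨ cong (classify ε) (seq≡Q l v′) ⟩
            classify ε (Q l v′)
              ≡⟨ classify-cong (above {v′} {v} l (flip v v′ same)) (above {v} {v′} l same)
                               (below {v′} {v} l (flip v v′ same)) (below {v} {v′} l same) ⟩
            classify ε (Q l v)                  ≡⟨ cong (classify ε) (seq≡Q l v) ⟨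
            classify ε (seq (e (l , v)) k)      ≡⟨ approx (l , v) (lookup σ l) (hs l) ⟩
            lookup σ l                          ∎

  ¬¬-integerForms : ¬ ¬ (∃[ x ] ∃[ θ ] (∀ v v′ → SameSums x θ v v′ → ∀ σ →
    HasSigns f (place (lookup v)) σ → HasSigns f (place (lookup v′)) σ))
  ¬¬-integerForms =
    ¬¬-approximation enum-J e >>= λ (ε , k , _ , approx) →
    -- With the unit type as witness, this only moves the double negation out of a finite
    -- conjunction.
    ¬¬-common enum-J (λ j _ → ∃[ s ] HasSign (e j) s) (λ _ _ → tt) tt (λ hs → hs) (λ hs → hs)
      (λ j → sign-exists (e j) >>= λ hs → return (tt , hs)) >>= λ (_ , signed) →
    ¬¬-commonDenominator (enum-⊎ (enum-× enum-Fin (enum-× enum-Fin enum-Fin)) enum-Fin)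
      (scaled ε k approx signed) >>= λ (D , 0<D , int) →
    let x-int = λ l a i → int (inj₁ (l , a , i)); ε-int = int (inj₂ zero); -ε-int = int (inj₂ (suc zero)) in
    return (x ε k approx signed D 0<D x-int ε-int -ε-int , θ ε k approx signed D 0<D x-int ε-int -ε-int ,
      λ v v′ same σ → transferSigns ε k approx signed D 0<D x-int ε-int -ε-int v v′ same σ)

-- Images and homogeneous sets

Increasing⇒injective : ∀ {r N} (i : Fin r → Fin N) → StrictlyIncreasing i → ∀ {a b} → i a ≡ i b → a ≡ b
Increasing⇒injective i inc {a} {b} eq with Fin.<-cmp a b
... | tri< a<b _ _ = contradiction eq (Fin.<⇒≢ (inc a<b))
... | tri≈ _ a≡b _ = a≡b
... | tri> _ _ b<a = contradiction (sym eq) (Fin.<⇒≢ (inc b<a))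

∈-image⁻ : ∀ {r N} (v : Fin r → Fin N) {y} → y ∈ˢ ⟦ v ⟧ → ∃[ a ] y ≡ v a
∈-image⁻ {zero}  v y∈ = contradiction y∈ Subset.∉⊥
∈-image⁻ {suc r} v y∈ with Subset.x∈p∪q⁻ ⁅ v zero ⁆ _ y∈
... | inj₁ y∈₀ = zero , Subset.x∈⁅y⁆⇒x≡y (v zero) y∈₀
... | inj₂ y∈ₛ = let a , eq = ∈-image⁻ (v ∘ suc) y∈ₛ in suc a , eq

∈-image⁺ : ∀ {r N} (v : Fin r → Fin N) a → v a ∈ˢ ⟦ v ⟧
∈-image⁺ {suc r} v zero    = Subset.x∈p∪q⁺ (inj₁ (Subset.x∈⁅x⁆ (v zero)))
∈-image⁺ {suc r} v (suc a) = Subset.x∈p∪q⁺ {p = ⁅ v zero ⁆} (inj₂ (∈-image⁺ (v ∘ suc) a))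

∣⁅x⁆∪p∣ : ∀ {n} (x : Fin n) p → x ∉ˢ p → ∣ ⁅ x ⁆ ∪ p ∣ˢ ≡ suc ∣ p ∣ˢ
∣⁅x⁆∪p∣ zero    (inside  ∷ p) x∉p = contradiction here x∉p
∣⁅x⁆∪p∣ zero    (outside ∷ p) x∉p = cong (suc ∘ ∣_∣ˢ) (Subset.∪-identityˡ p)
∣⁅x⁆∪p∣ (suc x) (inside  ∷ p) x∉p = cong suc (∣⁅x⁆∪p∣ x p (x∉p ∘ there))
∣⁅x⁆∪p∣ (suc x) (outside ∷ p) x∉p = ∣⁅x⁆∪p∣ x p (x∉p ∘ there)

∣image∣ : ∀ {r N} (v : Fin r → Fin N) → (∀ {a b} → v a ≡ v b → a ≡ b) → ∣ ⟦ v ⟧ ∣ˢ ≡ r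
∣image∣ {zero}  {N} v inj = Subset.∣⊥∣≡0 N
∣image∣ {suc r} v inj = trans
  (∣⁅x⁆∪p∣ (v zero) ⟦ v ∘ suc ⟧ λ v₀∈ → Fin.0≢1+n (inj (proj₂ (∈-image⁻ (v ∘ suc) v₀∈))))
  (cong suc (∣image∣ (v ∘ suc) (Fin.suc-injective ∘ inj)))

image-cong : ∀ {r N} {v w : Fin r → Fin N} → (∀ a → v a ≡ w a) → ⟦ v ⟧ ≡ ⟦ w ⟧
image-cong v≗w = cong ⋃ (List.tabulate-cong (cong ⁅_⁆ ∘ v≗w))

members : ∀ {n} (e : Subset n) → Fin ∣ e ∣ˢ → Fin n
members (inside  ∷ e) zero    = zero
members (inside  ∷ e) (suc a) = suc (members e a)
members (outside ∷ e) a       = suc (members e a)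

members-increasing : ∀ {n} (e : Subset n) → StrictlyIncreasing (members e)
members-increasing (inside  ∷ e) {zero}  {suc b} _         = s≤s z≤n
members-increasing (inside  ∷ e) {suc a} {suc b} (s≤s a<b) = s≤s (members-increasing e a<b)
members-increasing (outside ∷ e) a<b                       = s≤s (members-increasing e a<b)

members-∈ : ∀ {n} (e : Subset n) a → members e a ∈ˢ e
members-∈ (inside  ∷ e) zero    = here
members-∈ (inside  ∷ e) (suc a) = there (members-∈ e a)
members-∈ (outside ∷ e) a       = there (members-∈ e a)

members-surjective : ∀ {n} (e : Subset n) {x} → x ∈ˢ e → ∃[ a ] x ≡ members e a
members-surjective (inside  ∷ e) here        = zero , refl
members-surjective (inside  ∷ e) (there x∈e) = let a , eq = members-surjective e x∈e in suc a , cong suc eq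
members-surjective (outside ∷ e) (there x∈e) = let a , eq = members-surjective e x∈e in a , cong suc eq

-- The preimage of `e` under `W` is listed in increasing order. The order is that of the indices: in
-- the application `W` involves the enumeration of the vertices and may permute them.
subset-of-image : ∀ {n N} (W : Fin n → Fin N) → (∀ {a b} → W a ≡ W b → a ≡ b) → ∀ e → e ⊆ˢ ⟦ W ⟧ →
  ∃[ i ] (StrictlyIncreasing {∣ e ∣ˢ} i × ⟦ W ∘ i ⟧ ≡ e)
subset-of-image {n} W inj e e⊆ = subst (λ s → ∃[ i ] (StrictlyIncreasing {s} i × ⟦ W ∘ i ⟧ ≡ e))
    (trans (sym (∣image∣ (W ∘ members e′) (Increasing⇒injective (members e′) (members-increasing e′) ∘ inj)))
      (cong ∣_∣ˢ image≡))
    (members e′ , (λ {a} {b} → members-increasing e′ {a} {b}) , image≡)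
  where
  e′ : Subset n
  e′ = tabulate (λ a → lookup e (W a))

  ∈e′⇒ : ∀ {a} → a ∈ˢ e′ → W a ∈ˢ e
  ∈e′⇒ {a} a∈ = Vec.lookup⇒[]= (W a) e (trans (sym (Vec.lookup∘tabulate (λ a → lookup e (W a)) a)) (Vec.[]=⇒lookup a∈))

  ⇒∈e′ : ∀ {a} → W a ∈ˢ e → a ∈ˢ e′
  ⇒∈e′ {a} Wa∈ = Vec.lookup⇒[]= a e′ (trans (Vec.lookup∘tabulate (λ a → lookup e (W a)) a) (Vec.[]=⇒lookup Wa∈))

  image⊆ : ⟦ W ∘ members e′ ⟧ ⊆ˢ e
  image⊆ y∈ = let a , eq = ∈-image⁻ (W ∘ members e′) y∈ in subst (_∈ˢ e) (sym eq) (∈e′⇒ (members-∈ e′ a))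

  ⊆image : e ⊆ˢ ⟦ W ∘ members e′ ⟧
  ⊆image {y} y∈ = let a , y≡ = ∈-image⁻ W (e⊆ y∈)
                      b , a≡ = members-surjective e′ (⇒∈e′ (subst (_∈ˢ e) y≡ y∈))
                  in subst (_∈ˢ ⟦ W ∘ members e′ ⟧) (sym (trans y≡ (cong W a≡))) (∈-image⁺ (W ∘ members e′) b)

  image≡ : ⟦ W ∘ members e′ ⟧ ≡ e
  image≡ = Subset.⊆-antisym image⊆ ⊆image

allSubsets? : ∀ {n} {P : Subset n → Set} → (∀ e → Dec (P e)) → Dec (∀ e → P e)
allSubsets? P? = map′ (λ none e → decidable-stable (P? e) λ ¬Pe → none (e , ¬Pe)) (λ all (e , ¬Pe) → ¬Pe (all e))
  (¬? (Subset.anySubset? (¬? ∘ P?)))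

module _ {r N : ℕ} (H : UniformHypergraph r N) where

  open UniformHypergraph H using (isEdge)

  homogeneous? : ∀ n → Dec (∃[ S ] (∣ S ∣ˢ ≡ n × (IsClique H S ⊎ IsIndependent H S)))
  homogeneous? n = Subset.anySubset? λ S → (∣ S ∣ˢ ≟ n) ×-dec
    (allSubsets? (λ e → (∣ e ∣ˢ ≟ r) →-dec ((e Subset.⊆? S) →-dec Bool.T? (isEdge e))) ⊎-dec
     allSubsets? (λ e → (∣ e ∣ˢ ≟ r) →-dec ((e Subset.⊆? S) →-dec ¬? (Bool.T? (isEdge e)))))

  -- A finite search for a single edge inside the set decides between the alternatives, and `same`
  -- spreads an edge that is found to all `r`-subsets.
  indiscernible⇒homogeneous : ∀ {n} (W : Fin n → Fin N) → (∀ {a b} → W a ≡ W b → a ≡ b) →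
    (∀ (i i′ : Fin r → Fin n) → StrictlyIncreasing i → StrictlyIncreasing i′ →
      Edge H ⟦ W ∘ i ⟧ → Edge H ⟦ W ∘ i′ ⟧) →
    ∃[ S ] (∣ S ∣ˢ ≡ n × (IsClique H S ⊎ IsIndependent H S))
  indiscernible⇒homogeneous {n} W inj same = S , ∣image∣ W inj , cliqueOrIndependent
    where
    S : Subset N
    S = ⟦ W ⟧

    asTuple : ∀ e → ∣ e ∣ˢ ≡ r → e ⊆ˢ S → ∃[ i ] (StrictlyIncreasing {r} i × ⟦ W ∘ i ⟧ ≡ e)
    asTuple e refl e⊆S = subset-of-image W inj e e⊆S

    cliqueOrIndependent : IsClique H S ⊎ IsIndependent H S
    cliqueOrIndependent
      with Subset.anySubset? (λ e → (∣ e ∣ˢ ≟ r) ×-dec ((e Subset.⊆? S) ×-dec Bool.T? (isEdge e)))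
    ... | no none = inj₂ λ e ∣e∣≡r e⊆S edge → none (e , ∣e∣≡r , e⊆S , edge)
    ... | yes (e , ∣e∣≡r , e⊆S , edge) = inj₁ λ e′ ∣e′∣≡r e′⊆S →
      let i  , inc  , i≡  = asTuple e ∣e∣≡r e⊆S
          i′ , inc′ , i′≡ = asTuple e′ ∣e′∣≡r e′⊆S
      in subst (Edge H) i′≡ (same i i′ inc inc′ (subst (Edge H) (sym i≡) edge))

-- From integer forms to homogeneous vertex sets

sufficient : ℕ → ℕ → ℕ → ℕ
-- The factor 2 inside `room` counts the thresholds of each form, one for either side of zero.
sufficient m r n = treeSize (m * suc r) (room (m * suc r * 2) n (suc r) ^ suc (m * suc r * (m * suc r)))

module _ (m r d n N : ℕ) (N-large : sufficient m r n ≤ N) (H : UniformHypergraph (suc r) N)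
  (Δ : Description d 1 m (suc r) N) (place : (Fin (suc r) → Fin N) → Fin (suc r) → Fin d → ℝ)
  (place≡ : ∀ i a → place i a ≡ Description.point Δ (i a))
  (describes : ∀ (i : Fin (suc r) → Fin N) → StrictlyIncreasing i →
    Edge H ⟦ (Description.enumeration Δ ⟨$⟩ʳ_) ∘ i ⟧ ⇔
    (∃[ s ] (HasSigns (Description.poly Δ) (place i) s × T (Description.Φ Δ s)))) where

  open Description Δ

  private
    module _ x θ
      (transferSigns : ∀ v v′ → SameSums poly degree point place place≡ x θ v v′ → ∀ σ →
        HasSigns poly (place (lookup v)) σ → HasSigns poly (place (lookup v′)) σ)
      (z : Fin n → Fin N) (z< : StrictlyIncreasing z) (decided : AllSumsDecided m r 2 n N x θ z) where

      W : Fin n → Fin N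
      W = (enumeration ⟨$⟩ʳ_) ∘ z

      inj : ∀ {a b} → W a ≡ W b → a ≡ b
      inj = Increasing⇒injective z (λ {a} {b} → z< {a} {b}) ∘ λ eq →
        trans (sym (Permutation.inverseˡ enumeration))
          (trans (cong (enumeration ⟨$⟩ˡ_) eq) (Permutation.inverseˡ enumeration))

      tuple : (Fin (suc r) → Fin n) → Vec (Fin N) (suc r)
      tuple i = tabulate (z ∘ i)

      lookup-tuple : ∀ i a → lookup (tuple i) a ≡ z (i a)
      lookup-tuple i = Vec.lookup∘tabulate (z ∘ i)

      tuple-increasing : ∀ i → StrictlyIncreasing i → StrictlyIncreasing (lookup (tuple i))
      tuple-increasing i inc {a} {b} a<b =
        subst₂ Fin._<_ (sym (lookup-tuple i a)) (sym (lookup-tuple i b)) (z< (inc a<b))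

      sums : ∀ i l → sum (λ a → x l a (lookup (tuple i) a)) ≡ sum (λ a → x l a (z (i a)))
      sums i l = sum-cong-≗ λ a → cong (x l a) (lookup-tuple i a)

      sameSums : ∀ i i′ → StrictlyIncreasing i → StrictlyIncreasing i′ →
        SameSums poly degree point place place≡ x θ (tuple i) (tuple i′)
      sameSums i i′ inc inc′ l c =
        [ (λ always → (λ _ → toTuple i′ (always i′ inc′)) , (λ _ → toTuple i (always i inc)))
        , (λ never → (λ h → contradiction (fromTuple i h) (never i inc)) ,
                     (λ h → contradiction (fromTuple i′ h) (never i′ inc′)))
        ]′ (decided l c)
        where
        toTuple : ∀ i → θ l c ℤ.< sum (λ a → x l a (z (i a))) → θ l c ℤ.< sum (λ a → x l a (lookup (tuple i) a))
        toTuple i = subst (θ l c ℤ.<_) (sym (sums i l))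

        fromTuple : ∀ i → θ l c ℤ.< sum (λ a → x l a (lookup (tuple i) a)) → θ l c ℤ.< sum (λ a → x l a (z (i a)))
        fromTuple i = subst (θ l c ℤ.<_) (sums i l)

      image≡ : ∀ i → ⟦ (enumeration ⟨$⟩ʳ_) ∘ lookup (tuple i) ⟧ ≡ ⟦ W ∘ i ⟧
      image≡ i = image-cong λ a → cong (enumeration ⟨$⟩ʳ_) (lookup-tuple i a)

      same : ∀ i i′ → StrictlyIncreasing i → StrictlyIncreasing i′ → Edge H ⟦ W ∘ i ⟧ → Edge H ⟦ W ∘ i′ ⟧
      same i i′ inc inc′ edge =
        let σ , signs , Φσ = Equivalence.to (describes (lookup (tuple i)) (tuple-increasing i inc))
                               (subst (Edge H) (sym (image≡ i)) edge)
        in subst (Edge H) (image≡ i′)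
             (Equivalence.from (describes (lookup (tuple i′)) (tuple-increasing i′ inc′))
               (σ , transferSigns (tuple i) (tuple i′) (sameSums i i′ inc inc′) σ signs , Φσ))

      conclude : ∃[ S ] (∣ S ∣ˢ ≡ n × (IsClique H S ⊎ IsIndependent H S))
      conclude = indiscernible⇒homogeneous H W inj same

  homogeneousSet : ∃[ S ] (∣ S ∣ˢ ≡ n × (IsClique H S ⊎ IsIndependent H S))
  homogeneousSet = decidable-stable (homogeneous? H n)
    (¬¬-integerForms poly degree point place place≡ >>= λ (x , θ , transferSigns) →
      let z , z< , decided = semilinearRamsey m r 2 n N x θ N-large in
      return (conclude x θ transferSigns z z< decided))

ramsey : ∀ m r d n N → sufficient m r n ≤ N → RamseyProperty (suc r) d 1 m n N
ramsey m r d n N N-large H (Δ , describes) =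
  homogeneousSet m r d n N N-large H Δ (λ i → Description.point Δ ∘ i) (λ _ _ → refl) describes

-- The size of the bound

^-distribʳ-* : ∀ p a b → (a * b) ^ p ≡ a ^ p * b ^ p
^-distribʳ-* zero    a b = refl
^-distribʳ-* (suc p) a b = trans (cong (a * b *_) (^-distribʳ-* p a b)) ([m*n]*[o*p]≡[m*o]*[n*p] a b (a ^ p) (b ^ p))

module _ (m r : ℕ) where

  private
    -- For positive `n` the room is at most `A * n` and the tree length at most `G * n ^ P`, while
    -- `q` counts the ternary tests. None of them depends on `d` or `n`.
    k P A G q : ℕ
    k = m * suc r
    P = suc (k * k)
    A = 2 + 2 ^ (k * 2) * (2 * spacing (suc r))
    G = 2 ^ k * (2 * A ^ P)
    q = k * k + k

  ramseyConstant : ℕ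
  ramseyConstant = suc (G * q) * G

  ramseyConstant>0 : 0 < ramseyConstant
  ramseyConstant>0 = *-mono-≤ {1} {suc (G * q)} (s≤s z≤n)
    (*-mono-≤ (m^n>0 2 k) (*-mono-≤ {1} {2} (s≤s z≤n) (m^n>0 A P)))

  private
    module _ (n : ℕ) (0<n : 0 < n) where
      open ≤-Reasoning

      instance
        n≢0 : NonZero n
        n≢0 = >-nonZero 0<n

      room≤ : room (k * 2) n (suc r) ≤ A * n
      room≤ = begin
        2 + 2 ^ (k * 2) * (suc n * spacing (suc r))
          ≤⟨ +-mono-≤ (*-monoʳ-≤ 2 0<n) (*-monoʳ-≤ (2 ^ (k * 2)) (*-monoˡ-≤ (spacing (suc r)) (+-monoˡ-≤ n 0<n))) ⟩
        2 * n + 2 ^ (k * 2) * ((n + n) * spacing (suc r))     ≡⟨ rearrange n (2 ^ (k * 2)) (spacing (suc r)) ⟩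
        A * n                                                 ∎
        where
        rearrange : ∀ n p s → 2 * n + p * ((n + n) * s) ≡ (2 + p * (2 * s)) * n
        rearrange = solve-∀

      len : ℕ
      len = treeLength k (room (k * 2) n (suc r) ^ P)

      treeLength≤ : len ≤ G * n ^ P
      treeLength≤ = begin
        2 ^ k * suc (room (k * 2) n (suc r) ^ P)        ≤⟨ *-monoʳ-≤ (2 ^ k) (s≤s (^-monoˡ-≤ P room≤)) ⟩
        2 ^ k * suc ((A * n) ^ P)                       ≡⟨ cong (λ a → 2 ^ k * suc a) (^-distribʳ-* P A n) ⟩
        2 ^ k * suc (A ^ P * n ^ P)
          ≤⟨ *-monoʳ-≤ (2 ^ k) (+-monoˡ-≤ (A ^ P * n ^ P) (*-mono-≤ (m^n>0 A P) (m^n>0 n P))) ⟩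
        2 ^ k * (A ^ P * n ^ P + A ^ P * n ^ P)         ≡⟨ rearrange (2 ^ k) (A ^ P) (n ^ P) ⟩
        G * n ^ P                                       ∎
        where
        rearrange : ∀ p a b → p * (a * b + a * b) ≡ p * (2 * a) * b
        rearrange = solve-∀

      -- Each of the two units in `P + P` is absorbed by a further `k * k`, which is at least one.
      exponents : 0 < k → P + P ≤ 4 * suc r ^ 2 * m ^ 2
      exponents 0<k = begin
        suc (k * k) + suc (k * k)            ≤⟨ +-mono-≤ (+-monoˡ-≤ (k * k) 1≤k²) (+-monoˡ-≤ (k * k) 1≤k²) ⟩
        k * k + k * k + (k * k + k * k)      ≡⟨ rearrange m (suc r) ⟩
        4 * suc r ^ 2 * m ^ 2                ∎
        where
        1≤k² : 1 ≤ k * k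
        1≤k² = *-mono-≤ 0<k 0<k

        rearrange : ∀ m r → m * r * (m * r) + m * r * (m * r) + (m * r * (m * r) + m * r * (m * r)) ≡
          4 * (r * (r * 1)) * (m * (m * 1))
        rearrange = solve-∀

      exponent≤ : 0 < k → suc (len * q) * len ≤ ramseyConstant * n ^ (4 * suc r ^ 2 * m ^ 2)
      exponent≤ 0<k = begin
        suc (len * q) * len         ≤⟨ *-mono-≤ (s≤s (*-monoˡ-≤ q treeLength≤)) treeLength≤ ⟩
        suc (G * n ^ P * q) * (G * n ^ P)
          ≤⟨ *-monoˡ-≤ (G * n ^ P) (+-monoˡ-≤ (G * n ^ P * q) (m^n>0 n P)) ⟩
        (n ^ P + G * n ^ P * q) * (G * n ^ P)                   ≡⟨ rearrange (n ^ P) G q ⟩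
        ramseyConstant * (n ^ P * n ^ P)                        ≡⟨ cong (ramseyConstant *_) (^-distribˡ-+-* n P P) ⟨
        ramseyConstant * n ^ (P + P)                            ≤⟨ *-monoʳ-≤ ramseyConstant (^-monoʳ-≤ n (exponents 0<k)) ⟩
        ramseyConstant * n ^ (4 * suc r ^ 2 * m ^ 2)            ∎
        where
        rearrange : ∀ a g q → (a + g * a * q) * (g * a) ≡ (1 + g * q) * g * (a * a)
        rearrange = solve-∀

  sufficient≤ : 0 < m → ∀ n → 0 < n → sufficient m r n ≤ 2 ^ (ramseyConstant * n ^ (4 * suc r ^ 2 * m ^ 2))
  sufficient≤ 0<m n 0<n = ^-monoʳ-≤ 2 (exponent≤ n 0<n (*-mono-≤ 0<m (s≤s {n = r} z≤n)))

theorem3 : ∀ (r m : ℕ) → 0 < r → 0 < m →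
    ∃[ c ] (0 < c ×
    (∀ (d n : ℕ) → 0 < d → 0 < n →
    RamseyProperty r d 1 m n HasLeast≤ 2 ^ (c * n ^ (4 * r ^ 2 * m ^ 2))))
theorem3 (suc r) m _ 0<m = ramseyConstant m r , ramseyConstant>0 m r , λ d n _ 0<n →
  let B   = 2 ^ (ramseyConstant m r * n ^ (4 * suc r ^ 2 * m ^ 2))
      B-ramsey = ramsey m r d n B (sufficient≤ m r 0<m n 0<n)
  in (B , B-ramsey , ≤-refl) , λ R (_ , least) → least B B-ramsey
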